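{- For every integer $n\ge 2$, each of the following four integer-valued statistics is Entringerian, i.e. the underlying set has cardinality $E_n$ and for every $m\in\{1,\dots,n\}$ the number of its elements $w$ at which the statistic takes the value $m$ equals $E_n(m)$: (i) $w\mapsto \mathbf{F}\,w$ on $\mathrm{And}_n^{I}$; (ii) $w\mapsto n-\mathbf{NL}\,w$ on $\mathrm{And}_n^{I}$; (iii) $w\mapsto (n+1)-\mathbf{L}\,w$ on $\mathrm{And}_n^{II}$; (iv) $w\mapsto n-\mathbf{grn}\,w$ on $\mathrm{And}_n^{II}$.
   Context: Permutations of a finite set $Y$ of positive integers are written as words $w=x_1x_2\cdots x_n$ whose letters are the elements of $Y$; $e$ is the empty word; $\min(w)$, $\max(w)$ are the smallest and largest letters. Andr\'e permutations: the empty word and every one-letter word are Andr\'e I and Andr\'e II permutations. If $w$ is a permutation of $Y$ with $|Y|\ge 2$, write $w=v\,\min(w)\,v'$ (juxtaposition); $w$ is an Andr\'e I (resp. Andr\'e II) permutation if both $v$ and $v'$ are Andr\'e I (resp. Andr\'e II) permutations and $\max(vv')$ (resp. $\min(vv')$) is a letter of $v'$. $\mathrm{And}_n^{I}$ (resp. $\mathrm{And}_n^{II}$) is the set of Andr\'e I (resp. II) permutations of $\{1,\dots,n\}$. Statistics on $w=x_1\cdots x_n$: $\mathbf{F}\,w=x_1$ (first letter), $\mathbf{L}\,w=x_n$ (last letter), $\mathbf{NL}\,w=x_{n-1}$ (next to last letter, $n\ge2$), and $\mathbf{grn}\,w=\max\{x_{i-1},x_{i+1}\}$ where $x_i=n$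 is the maximum letter, with the convention $x_0=x_{n+1}=0$. Tangent/secant numbers $E_n$: $\sum_{n\ge0}E_n u^n/n!=\tan u+\sec u$. Entringer numbers $E_n(m)$ ($1\le m\le n$) are defined by $E_1(1)=1$, $E_n(n)=0$ for $n\ge2$, and $E_n(m+1)-E_n(m)+E_{n-1}(n-m)=0$ for $n\ge2$, $1\le m\le n-1$ (equivalently, $E_n(m)$ is the number of permutations $x_1\cdots x_n$ of $\{1,\dots,n\}$ with $x_1<x_2>x_3<x_4>\cdots$ and $x_1=m$). -}

module Defs where

open import Data.Nat using (ℕ; zero; suc; _+_; _∸_; _≤_; _<_; _⊔_)
open import Data.Nat.Combinatorics using (_C_)
open import Data.Integer as ℤ using (ℤ; +_; -_)
open import Data.List using (List; []; _∷_; _++_; [_]; map; upTo; length; filter; foldr)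
open import Data.List.Relation.Unary.All using (All)
open import Data.List.Relation.Unary.Unique.Propositional using (Unique)
open import Data.List.Membership.Propositional using (_∈_)
open import Data.List.Relation.Binary.Permutation.Propositional using (_↭_)
open import Data.Product using (Σ; _×_)
open import Data.Nat using (_≟_)
open import Relation.Binary.PropositionalEquality using (_≡_)
open import Function.Bundles using (_⇔_)
open import Relation.Nullary using (yes; no)

-- Tangent/secant numbers E_n, defined by  tan u + sec u = (1 + sin u) / cos u,
-- i.e. (Σ E_n u^n/n!) · cos u = 1 + sin u.  Comparing coefficients of u^N/N!:
--   Σ_{k=0}^{N} C(N,k) E_k c_{N-k} = [N = 0] + s_N,
-- where c_j = cos^{(j)}(0) and s_j = sin^{(j)}(0).  Since c_0 = 1 this
-- determines E_N from E_0, …, E_{N-1}.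

cosCoeff : ℕ → ℤ
cosCoeff 0 = + 1
cosCoeff 1 = + 0
cosCoeff (suc (suc j)) = - cosCoeff j

sinCoeff : ℕ → ℤ
sinCoeff 0 = + 0
sinCoeff 1 = + 1
sinCoeff (suc (suc j)) = - sinCoeff j

nth : ℕ → List ℤ → ℤ
nth _ [] = + 0
nth zero (x ∷ _) = x
nth (suc k) (_ ∷ xs) = nth k xs

sumℤ : List ℤ → ℤ
sumℤ = foldr ℤ._+_ (+ 0)

tanSecTable : ℕ → List ℤ
tanSecTable zero = + 1 ∷ []
tanSecTable (suc N) =
  tanSecTable N ++
  [ sinCoeff (suc N) ℤ.-
      sumℤ (map (λ k → (+ (suc N C k)) ℤ.* nth k (tanSecTable N) ℤ.* cosCoeff (suc N ∸ k))
                (upTo (suc N))) ]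

E : ℕ → ℤ
E N = nth N (tanSecTable N)

-- Entringer numbers.  entD n d = E_n(n - d).  The clauses encode
--   E_1(1) = 1,  E_n(n) = 0 (n ≥ 2),
--   E_n(m) = E_n(m+1) + E_{n-1}(n-m)   (n ≥ 2, 1 ≤ m ≤ n-1),
-- with m = n - (d+1).  (Values outside 1 ≤ m ≤ n are irrelevant.)

entD : ℕ → ℕ → ℕ
entD zero _ = 0
entD (suc zero) zero = 1
entD (suc zero) (suc _) = 0
entD (suc (suc k)) zero = 0
entD (suc (suc k)) (suc d) = entD (suc (suc k)) d + entD (suc k) (k ∸ d)

Entringer : ℕ → ℕ → ℕ
Entringer n m = entD n (n ∸ m)

Word : Set
Word = List ℕ

oneToN : ℕ → Word
oneToN n = map suc (upTo n)

IsPerm : ℕ → Word → Set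
IsPerm n w = w ↭ oneToN n

data AndreI : Word → Set where
  empty  : AndreI []
  single : ∀ x → AndreI [ x ]
  split  : ∀ v x v' →
           All (x <_) (v ++ v') →
           AndreI v → AndreI v' →
           Σ ℕ (λ y → y ∈ v' × All (_≤ y) (v ++ v')) →
           AndreI (v ++ x ∷ v')

data AndreII : Word → Set where
  empty  : AndreII []
  single : ∀ x → AndreII [ x ]
  split  : ∀ v x v' →
           All (x <_) (v ++ v') →
           AndreII v → AndreII v' →
           Σ ℕ (λ y → y ∈ v' × All (y ≤_) (v ++ v')) →
           AndreII (v ++ x ∷ v')

AndI : ℕ → Word → Set
AndI n w = IsPerm n w × AndreI w

AndII : ℕ → Word → Set
AndII n w = IsPerm n w × AndreII w

-- Statistics (default value 0 on words too short; irrelevant for n ≥ 2)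

F : Word → ℕ
F [] = 0
F (x ∷ _) = x

L : Word → ℕ
L [] = 0
L (x ∷ []) = x
L (_ ∷ y ∷ w) = L (y ∷ w)

NL : Word → ℕ
NL [] = 0
NL (_ ∷ []) = 0
NL (x ∷ _ ∷ []) = x
NL (_ ∷ y ∷ z ∷ w) = NL (y ∷ z ∷ w)

-- grnAux n prev w : scanning w, with prev the letter preceding w (0 at start);
-- at the letter equal to n return max(prev, next) with next = 0 at the end.
grnAux : ℕ → ℕ → Word → ℕ
grnAux n prev [] = 0
grnAux n prev (x ∷ w) with x ≟ n
... | yes _ = prev ⊔ F w
... | no _ = grnAux n x w

grn : ℕ → Word → ℕ
grn n w = grnAux n 0 w

-- A statistic `stat` on the set {w | S w} is Entringerian (for n): the set is
-- finite with cardinality E_n (witnessed by a duplicate-free list enumerating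
-- it exactly) and, for 1 ≤ m ≤ n, exactly E_n(m) of its elements have
-- statistic m.

Entringerian : ℕ → (Word → Set) → (Word → ℕ) → Set
Entringerian n S stat =
  Σ (List Word) λ ws →
    Unique ws ×
    (∀ w → (w ∈ ws) ⇔ S w) ×
    (+ length ws ≡ E n) ×
    (∀ m → 1 ≤ m → m ≤ n → length (filter (λ w → stat w ≟ m) ws) ≡ Entringer n m)

{-# OPTIONS --safe #-}

-- Splitting a word at its smallest letter turns each count into a sum over the
-- ways to distribute the other letters, i.e. into a product of exponential
-- generating functions.  Let z be that of E_n, and for each statistic let the
-- coefficient of x^a y^b / (a! b!) count the words at which its value has a
-- smaller and b larger letters (the letter n being left out for NL and grn).
-- The series P of NL and of grn satisfies ∂x P = z(x+y) P and P(0,y) = z(y), that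
-- of L is 1 + ∫ P dx, and that of F satisfies ∂x ∂y G = z'(x+y) G.  The Entringer
-- triangle satisfies the same equations: its recurrence says that P and Q = ∂x G
-- obey ∂x P = ∂y P + Q and ∂y Q = ∂x Q + P, and both (∂x P, ∂x Q) and
-- (z(x+y) P, z(x+y) Q) solve this system with the same boundary values.  The same
-- recurrence, read as a rotation by a quarter turn, gives z cos = 1 + sin.
module Submission where

open import Defs
open import Data.Nat using (ℕ; _≤_; _∸_; _+_)
open import Data.Product using (_×_)
open import Data.Bool using (true; false; if_then_else_)
import Data.Integer as ℤ
open import Data.List using (List; []; _∷_; [_]; _++_; applyUpTo; cartesianProductWith; filter; length; map; uncons; upTo)
open import Data.List.Membership.Propositional using (_∈_; _∉_)
open import Data.List.Membership.Propositional.Properties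
  using (∈-++⁺ˡ; ∈-++⁺ʳ; ∈-++⁻; ∈-∃++; ∈-map⁻; ∈-cartesianProductWith⁺; ∈-cartesianProductWith⁻)
open import Data.List.Properties
  using ( ++-assoc; ++-identityʳ; ++-cancelˡ; ++-conicalˡ; ++-conicalʳ; ∷-injectiveʳ; length-++; length-map
        ; length-applyUpTo; map-upTo; applyUpTo-∷ʳ; filter-++; filter-none; filter-all; filter-≐)
open import Data.List.Relation.Binary.Permutation.Propositional
  using (_↭_; prep; ↭-refl; ↭-reflexive; ↭-sym; ↭-trans; module PermutationReasoning)
open import Data.List.Relation.Binary.Permutation.Propositional.Properties
  using (All-resp-↭; ∈-resp-↭; ↭-length; ↭-empty-inv; ↭-singleton-inv; shift; drop-mid; ++⁺; ¬x∷xs↭[])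
open import Data.List.Relation.Binary.Sublist.Propositional using (_⊆_; []; _∷_; _∷ʳ_; ⊆-refl; ⊆-trans; minimum)
import Data.List.Relation.Binary.Sublist.Propositional.Properties as ⊆
open import Data.List.Relation.Ternary.Interleaving.Propositional
  using (Interleaving; []; consˡ; consʳ; toPermutation; swap)
open import Data.List.Relation.Unary.All as All using (All; []; _∷_)
import Data.List.Relation.Unary.All.Properties as All
open import Data.List.Relation.Unary.AllPairs as AllPairs using (AllPairs; []; _∷_)
import Data.List.Relation.Unary.AllPairs.Properties as AllPairs
open import Data.List.Relation.Unary.Any using (here; there)
open import Data.List.Relation.Unary.Unique.Propositional using (Unique)
import Data.List.Relation.Unary.Unique.Propositional.Properties as Unique
open import Data.Maybe using (Maybe; just; nothing)
open import Data.Nat using (zero; suc; _*_; _<_; _≟_; _≡ᵇ_; z≤n; s≤s)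
open import Data.Nat.Combinatorics using (_C_; nCn≡1; nCk+nC[k+1]≡[n+1]C[k+1])
open import Data.Nat.Combinatorics.Specification using (k>n⇒nCk≡0)
open import Data.Nat.Properties
import Data.Nat.Tactic.RingSolver as ℕ-Solver
open import Data.Product using (Σ; ∃; ∃₂; _,_; proj₁; proj₂)
open import Data.Sum using (_⊎_; inj₁; inj₂)
open import Function using (_∘_)
open import Function.Bundles using (mk⇔)
open import Relation.Binary.PropositionalEquality hiding ([_])
open import Relation.Nullary using (¬_; yes; no; contradiction)

-- Exponential generating functions

-- Splitting at the smallest letter yields convolutions on André permutations, not the recurrence
-- that defines the triangle, so the two sides are compared through differential equations. In a
-- sorted word `lo ++ m ∷ hi` with marked value `m`, letters of `lo` are counted by x and letters of
-- `hi` by y. The part without `m` matters only through its number of letters, from whichever side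
-- of `m` they come; this is why its factor is a series in x+y. The root and the letter forced to
-- the right by the André condition are set aside before the others are distributed, and this
-- produces the derivatives. Since the other letters choose a side one at a time, a sum over splits
-- obeys Leibniz' rule by its very recursion. Products are therefore defined by that rule, and
-- binomial coefficients appear only to match the definition of `E`.

interchange : ∀ a b c d → (a + b) + (c + d) ≡ (a + c) + (b + d)
interchange = ℕ-Solver.solve-∀

∂x ∂y : (ℕ → ℕ → ℕ) → ℕ → ℕ → ℕ
∂x p a b = p (suc a) b
∂y p a b = p a (suc b)

infixl 7 _⋆_ _▷_

-- On exponential generating functions, f ⋆ g is the product f(y) g(y) and f ▷ p is
-- f(x+y) p(x,y), both given by Leibniz' rule.
_⋆_ : (ℕ → ℕ) → (ℕ → ℕ) → ℕ → ℕ
(f ⋆ g) zero    = f 0 * g 0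
(f ⋆ g) (suc n) = ((f ∘ suc) ⋆ g) n + (f ⋆ (g ∘ suc)) n

_▷_ : (ℕ → ℕ) → (ℕ → ℕ → ℕ) → ℕ → ℕ → ℕ
(f ▷ p) zero    b = (f ⋆ p 0) b
(f ▷ p) (suc a) b = ((f ∘ suc) ▷ p) a b + (f ▷ ∂x p) a b

⋆-cong : ∀ {f f' g g'} → f ≗ f' → g ≗ g' → f ⋆ g ≗ f' ⋆ g'
⋆-cong f≗f' g≗g' zero    = cong₂ _*_ (f≗f' 0) (g≗g' 0)
⋆-cong f≗f' g≗g' (suc n) =
  cong₂ _+_ (⋆-cong (f≗f' ∘ suc) g≗g' n) (⋆-cong f≗f' (g≗g' ∘ suc) n)

⋆-comm : ∀ f g → f ⋆ g ≗ g ⋆ f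
⋆-comm f g zero    = *-comm (f 0) (g 0)
⋆-comm f g (suc n) = begin
  ((f ∘ suc) ⋆ g) n + (f ⋆ (g ∘ suc)) n ≡⟨ cong₂ _+_ (⋆-comm (f ∘ suc) g n) (⋆-comm f (g ∘ suc) n) ⟩
  (g ⋆ (f ∘ suc)) n + ((g ∘ suc) ⋆ f) n ≡⟨ +-comm ((g ⋆ (f ∘ suc)) n) _ ⟩
  ((g ∘ suc) ⋆ f) n + (g ⋆ (f ∘ suc)) n ∎
  where open ≡-Reasoning

⋆-distribˡ : ∀ f g h → f ⋆ (λ n → g n + h n) ≗ λ n → (f ⋆ g) n + (f ⋆ h) n
⋆-distribˡ f g h zero    = *-distribˡ-+ (f 0) (g 0) (h 0)
⋆-distribˡ f g h (suc n) = trans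
  (cong₂ _+_ (⋆-distribˡ (f ∘ suc) g h n) (⋆-distribˡ f (g ∘ suc) (h ∘ suc) n))
  (interchange (((f ∘ suc) ⋆ g) n) _ _ _)

⋆-distribʳ : ∀ f g h → (λ n → g n + h n) ⋆ f ≗ λ n → (g ⋆ f) n + (h ⋆ f) n
⋆-distribʳ f g h n = begin
  ((λ i → g i + h i) ⋆ f) n ≡⟨ ⋆-comm _ f n ⟩
  (f ⋆ (λ i → g i + h i)) n ≡⟨ ⋆-distribˡ f g h n ⟩
  (f ⋆ g) n + (f ⋆ h) n     ≡⟨ cong₂ _+_ (⋆-comm f g n) (⋆-comm f h n) ⟩
  (g ⋆ f) n + (h ⋆ f) n     ∎
  where open ≡-Reasoning

⋆-assoc : ∀ f g h → (f ⋆ g) ⋆ h ≗ f ⋆ (g ⋆ h)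
⋆-assoc f g h zero    = *-assoc (f 0) (g 0) (h 0)
⋆-assoc f g h (suc n) = begin
  ((λ i → (f' ⋆ g) i + (f ⋆ g') i) ⋆ h) n + ((f ⋆ g) ⋆ h') n
    ≡⟨ cong (_+ ((f ⋆ g) ⋆ h') n) (⋆-distribʳ h (f' ⋆ g) (f ⋆ g') n) ⟩
  ((f' ⋆ g) ⋆ h) n + ((f ⋆ g') ⋆ h) n + ((f ⋆ g) ⋆ h') n
    ≡⟨ cong₂ _+_ (cong₂ _+_ (⋆-assoc f' g h n) (⋆-assoc f g' h n)) (⋆-assoc f g h' n) ⟩
  (f' ⋆ (g ⋆ h)) n + (f ⋆ (g' ⋆ h)) n + (f ⋆ (g ⋆ h')) n
    ≡⟨ +-assoc ((f' ⋆ (g ⋆ h)) n) _ _ ⟩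
  (f' ⋆ (g ⋆ h)) n + ((f ⋆ (g' ⋆ h)) n + (f ⋆ (g ⋆ h')) n)
    ≡⟨ cong ((f' ⋆ (g ⋆ h)) n +_) (⋆-distribˡ f (g' ⋆ h) (g ⋆ h') n) ⟨
  (f' ⋆ (g ⋆ h)) n + (f ⋆ (λ i → (g' ⋆ h) i + (g ⋆ h') i)) n ∎
  where
  open ≡-Reasoning
  f' = f ∘ suc ; g' = g ∘ suc ; h' = h ∘ suc

⋆-zeroʳ : ∀ f → f ⋆ (λ _ → 0) ≗ λ _ → 0
⋆-zeroʳ f zero    = *-zeroʳ (f 0)
⋆-zeroʳ f (suc n) = cong₂ _+_ (⋆-zeroʳ (f ∘ suc) n) (⋆-zeroʳ f n)

▷-cong : ∀ f {p p'} a → (∀ {i} → i ≤ a → ∀ j → p i j ≡ p' i j) → ∀ b → (f ▷ p) a b ≡ (f ▷ p') a b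
▷-cong f zero    p≗p' b = ⋆-cong (λ _ → refl) (p≗p' z≤n) b
▷-cong f (suc a) p≗p' b =
  cong₂ _+_ (▷-cong (f ∘ suc) a (p≗p' ∘ m≤n⇒m≤1+n) b) (▷-cong f a (p≗p' ∘ s≤s) b)

▷-congˡ : ∀ {f f'} p → f ≗ f' → ∀ a b → (f ▷ p) a b ≡ (f' ▷ p) a b
▷-congˡ p f≗f' zero    b = ⋆-cong f≗f' (λ _ → refl) b
▷-congˡ p f≗f' (suc a) b = cong₂ _+_ (▷-congˡ p (f≗f' ∘ suc) a b) (▷-congˡ (∂x p) f≗f' a b)

▷-distribˡ : ∀ f p q a b → (f ▷ λ i j → p i j + q i j) a b ≡ (f ▷ p) a b + (f ▷ q) a b
▷-distribˡ f p q zero    b = ⋆-distribˡ f (p 0) (q 0) b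
▷-distribˡ f p q (suc a) b = trans
  (cong₂ _+_ (▷-distribˡ (f ∘ suc) p q a b) (▷-distribˡ f (∂x p) (∂x q) a b))
  (interchange (((f ∘ suc) ▷ p) a b) _ _ _)

▷-distribʳ : ∀ p f g a b → ((λ n → f n + g n) ▷ p) a b ≡ (f ▷ p) a b + (g ▷ p) a b
▷-distribʳ p f g zero    b = ⋆-distribʳ (p 0) f g b
▷-distribʳ p f g (suc a) b = trans
  (cong₂ _+_ (▷-distribʳ p (f ∘ suc) (g ∘ suc) a b) (▷-distribʳ (∂x p) f g a b))
  (interchange (((f ∘ suc) ▷ p) a b) _ _ _)

⋆-▷-assoc : ∀ f g p a b → ((f ⋆ g) ▷ p) a b ≡ (f ▷ (g ▷ p)) a b
⋆-▷-assoc f g p zero    b = ⋆-assoc f g (p 0) b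
⋆-▷-assoc f g p (suc a) b = begin
  ((λ i → (f' ⋆ g) i + (f ⋆ g') i) ▷ p) a b + ((f ⋆ g) ▷ ∂x p) a b
    ≡⟨ cong (_+ ((f ⋆ g) ▷ ∂x p) a b) (▷-distribʳ p (f' ⋆ g) (f ⋆ g') a b) ⟩
  ((f' ⋆ g) ▷ p) a b + ((f ⋆ g') ▷ p) a b + ((f ⋆ g) ▷ ∂x p) a b
    ≡⟨ cong₂ _+_ (cong₂ _+_ (⋆-▷-assoc f' g p a b) (⋆-▷-assoc f g' p a b)) (⋆-▷-assoc f g (∂x p) a b) ⟩
  (f' ▷ (g ▷ p)) a b + (f ▷ (g' ▷ p)) a b + (f ▷ (g ▷ ∂x p)) a b
    ≡⟨ +-assoc ((f' ▷ (g ▷ p)) a b) _ _ ⟩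
  (f' ▷ (g ▷ p)) a b + ((f ▷ (g' ▷ p)) a b + (f ▷ (g ▷ ∂x p)) a b)
    ≡⟨ cong ((f' ▷ (g ▷ p)) a b +_) (▷-distribˡ f (g' ▷ p) (g ▷ ∂x p) a b) ⟨
  (f' ▷ (g ▷ p)) a b + (f ▷ (λ i j → (g' ▷ p) i j + (g ▷ ∂x p) i j)) a b ∎
  where
  open ≡-Reasoning
  f' = f ∘ suc ; g' = g ∘ suc

-- The definition of `▷` gives Leibniz' rule in x only. The rule in y has the same first term
-- because both partial derivatives of f(x+y) are f'(x+y).
▷-∂y : ∀ f p a b → (f ▷ p) a (suc b) ≡ ((f ∘ suc) ▷ p) a b + (f ▷ ∂y p) a b
▷-∂y f p zero    b = refl
▷-∂y f p (suc a) b = trans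
  (cong₂ _+_ (▷-∂y (f ∘ suc) p a b) (▷-∂y f (∂x p) a b))
  (interchange (((f ∘ suc ∘ suc) ▷ p) a b) _ _ _)

▷-0 : ∀ f p a → (f ▷ p) a 0 ≡ (f ⋆ λ i → p i 0) a
▷-0 f p zero    = refl
▷-0 f p (suc a) = cong₂ _+_ (▷-0 (f ∘ suc) p a) (▷-0 f (∂x p) a)

-- The equation determines row a + 1 from the rows up to a: the coefficient of f(x+y) u at (a, b)
-- involves only `u i j` with i ≤ a, as the restricted hypothesis of `▷-cong` records. Hence strong
-- induction on a.
linear-unique : ∀ f (s : ℕ → ℕ → ℕ) {u v : ℕ → ℕ → ℕ} → (∀ b → u 0 b ≡ v 0 b) →
  (∀ a b → ∂x u a b ≡ s a b + (f ▷ u) a b) → (∀ a b → ∂x v a b ≡ s a b + (f ▷ v) a b) →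
  ∀ a b → u a b ≡ v a b
linear-unique f s {u} {v} u₀≗v₀ u-eq v-eq a = upTo-a a ≤-refl
  where
  upTo-a : ∀ a {i} → i ≤ a → ∀ j → u i j ≡ v i j
  upTo-a a       {zero}  _         j = u₀≗v₀ j
  upTo-a (suc a) {suc i} (s≤s i≤a) j = begin
    u (suc i) j          ≡⟨ u-eq i j ⟩
    s i j + (f ▷ u) i j  ≡⟨ cong (s i j +_) (▷-cong f i (λ k≤i → upTo-a a (≤-trans k≤i i≤a)) j) ⟩
    s i j + (f ▷ v) i j  ≡⟨ v-eq i j ⟨
    v (suc i) j          ∎
    where open ≡-Reasoning

-- The Entringer triangle

-- The number E_n(m) with d = n − m and c = m − 1, so that n = 1 + d + c.
ent : ℕ → ℕ → ℕ
ent d c = entD (suc (d + c)) d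

ent-suc : ∀ d c → ent (suc d) c ≡ ent d (suc c) + ent c d
ent-suc d c = cong₂ _+_
  (cong (λ n → entD (suc n) d) (sym (+-suc d c)))
  (cong₂ (λ n → entD (suc n)) (+-comm d c) (m+n∸m≡n d c))

-- This is E_{n+1}(1). That it equals `E n` is shown only in `TangentSecant.E≡zig`; the differential
-- equations need the triangle alone.
zig : ℕ → ℕ
zig n = ent n 0

ent-1 : ∀ n → ent 1 n ≡ zig n
ent-1 n = ent-suc 0 n

zig-suc-suc : ∀ n → zig (suc (suc n)) ≡ ent (suc n) 1
zig-suc-suc n = trans (ent-suc (suc n) 0) (+-identityʳ _)

-- The last term of `ent-suc` has its indices exchanged, so the recurrence does not close up on a
-- single series. Reading the triangle in both orders, each with one index shifted, turns it into a
-- first-order linear system.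
P Q : ℕ → ℕ → ℕ
P a b = ent (suc a) b
Q a b = ent b (suc a)

P-∂x : ∀ a b → ∂x P a b ≡ ∂y P a b + Q a b
P-∂x a b = ent-suc (suc a) b

Q-∂y : ∀ a b → ∂y Q a b ≡ ∂x Q a b + P a b
Q-∂y a b = ent-suc b (suc a)

-- `ent 0` is the constant series 1, because E_1(1) = 1 and E_n(n) = 0 for n ≥ 2.
⋆-identityʳ : ∀ f → f ⋆ ent 0 ≗ f
⋆-identityʳ f zero    = *-identityʳ (f 0)
⋆-identityʳ f (suc n) = trans (cong₂ _+_ (⋆-identityʳ (f ∘ suc) n) (⋆-zeroʳ f n)) (+-identityʳ _)

-- The Seidel relations contain derivatives only through ∂x - ∂y, which annihilates z(x+y).
-- Multiplication by z(x+y) therefore preserves them.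
zig▷-seidelP : ∀ a b → ∂x (zig ▷ P) a b ≡ ∂y (zig ▷ P) a b + (zig ▷ Q) a b
zig▷-seidelP a b = begin
  ((zig ∘ suc) ▷ P) a b + (zig ▷ ∂x P) a b
    ≡⟨ cong (((zig ∘ suc) ▷ P) a b +_) (▷-cong zig a (λ _ → P-∂x _) b) ⟩
  ((zig ∘ suc) ▷ P) a b + (zig ▷ λ i j → ∂y P i j + Q i j) a b
    ≡⟨ cong (((zig ∘ suc) ▷ P) a b +_) (▷-distribˡ zig (∂y P) Q a b) ⟩
  ((zig ∘ suc) ▷ P) a b + ((zig ▷ ∂y P) a b + (zig ▷ Q) a b)
    ≡⟨ +-assoc (((zig ∘ suc) ▷ P) a b) _ _ ⟨
  ((zig ∘ suc) ▷ P) a b + (zig ▷ ∂y P) a b + (zig ▷ Q) a b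
    ≡⟨ cong (_+ (zig ▷ Q) a b) (▷-∂y zig P a b) ⟨
  ∂y (zig ▷ P) a b + (zig ▷ Q) a b ∎
  where open ≡-Reasoning

zig▷-seidelQ : ∀ a b → ∂y (zig ▷ Q) a b ≡ ∂x (zig ▷ Q) a b + (zig ▷ P) a b
zig▷-seidelQ a b = begin
  ∂y (zig ▷ Q) a b
    ≡⟨ ▷-∂y zig Q a b ⟩
  ((zig ∘ suc) ▷ Q) a b + (zig ▷ ∂y Q) a b
    ≡⟨ cong (((zig ∘ suc) ▷ Q) a b +_) (▷-cong zig a (λ _ → Q-∂y _) b) ⟩
  ((zig ∘ suc) ▷ Q) a b + (zig ▷ λ i j → ∂x Q i j + P i j) a b
    ≡⟨ cong (((zig ∘ suc) ▷ Q) a b +_) (▷-distribˡ zig (∂x Q) P a b) ⟩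
  ((zig ∘ suc) ▷ Q) a b + ((zig ▷ ∂x Q) a b + (zig ▷ P) a b)
    ≡⟨ +-assoc (((zig ∘ suc) ▷ Q) a b) _ _ ⟨
  ∂x (zig ▷ Q) a b + (zig ▷ P) a b ∎
  where open ≡-Reasoning

-- Both (∂x P, ∂x Q) and (zig ▷ P, zig ▷ Q) satisfy the Seidel relations, which
-- carry equality from the diagonal a + b = N to the next one once it is known
-- at the corner (0, N + 1).
Diagonal : ℕ → Set
Diagonal N = ∀ a b → a + b ≡ N →
  ∂x P a b ≡ (zig ▷ P) a b × ∂x Q a b ≡ (zig ▷ Q) a b

-- On x = 0 the claim says 2z' = z² up to the constant term. The hypothesis is a coefficient of z''
-- = z z', and (z²)' = 2 z z' makes it the next coefficient of the claim.
corner : ∀ N → ∂x P N 0 ≡ (zig ▷ P) N 0 → ∂x P 0 (suc N) ≡ (zig ▷ P) 0 (suc N)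
corner N eq = begin
  ent 2 (suc N)                                    ≡⟨ P-∂x 0 (suc N) ⟩
  ent 1 (suc (suc N)) + ent (suc N) 1              ≡⟨ cong₂ _+_ (ent-1 (suc (suc N))) (sym (zig-suc-suc N)) ⟩
  zig (suc (suc N)) + zig (suc (suc N))            ≡⟨ cong₂ _+_ eq' eq' ⟩
  (zig ⋆ (zig ∘ suc)) N + (zig ⋆ (zig ∘ suc)) N    ≡⟨ cong (_+ (zig ⋆ (zig ∘ suc)) N) (⋆-comm zig (zig ∘ suc) N) ⟩
  ((zig ∘ suc) ⋆ zig) N + (zig ⋆ (zig ∘ suc)) N    ≡⟨⟩
  (zig ⋆ zig) (suc N)                              ≡⟨ ⋆-cong (λ _ → refl) (sym ∘ ent-1) (suc N) ⟩
  (zig ▷ P) 0 (suc N)                              ∎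
  where
  open ≡-Reasoning
  eq' = trans eq (▷-0 zig P N)

diagonal : ∀ N → Diagonal N
diagonal zero    zero    zero    refl = refl , refl
diagonal (suc N) a b a+b≡ = P-diag a b a+b≡ , Q-diag a b a+b≡
  where
  open ≡-Reasoning
  P-diag : ∀ a b → a + b ≡ suc N → ∂x P a b ≡ (zig ▷ P) a b
  P-diag zero    b refl = corner N (proj₁ (diagonal N N 0 (+-identityʳ N)))
  P-diag (suc a) b a+b≡ = begin
    ∂x P (suc a) b                           ≡⟨ P-∂x (suc a) b ⟩
    ∂x P a (suc b) + ∂x Q a b                ≡⟨ cong₂ _+_ (P-diag a (suc b) (trans (+-suc a b) a+b≡))
                                                          (proj₂ (diagonal N a b (suc-injective a+b≡))) ⟩
    (zig ▷ P) a (suc b) + (zig ▷ Q) a b      ≡⟨ zig▷-seidelP a b ⟨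
    (zig ▷ P) (suc a) b                      ∎
  Q-diag : ∀ a b → a + b ≡ suc N → ∂x Q a b ≡ (zig ▷ Q) a b
  -- `Q a 0` is E_n(n) with n ≥ 2, so both sides vanish on y = 0.
  Q-diag a zero    a+b≡ = sym (trans (▷-0 zig Q a) (⋆-zeroʳ zig a))
  Q-diag a (suc b) a+b≡ = begin
    ∂x Q a (suc b)                           ≡⟨ Q-∂y (suc a) b ⟩
    ∂x Q (suc a) b + ∂x P a b                ≡⟨ cong₂ _+_ (Q-diag (suc a) b (trans (sym (+-suc a b)) a+b≡))
                                                          (proj₁ (diagonal N a b (suc-injective (trans (sym (+-suc a b)) a+b≡)))) ⟩
    (zig ▷ Q) (suc a) b + (zig ▷ P) a b      ≡⟨ zig▷-seidelQ a b ⟨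
    (zig ▷ Q) a (suc b)                      ∎

P-ode : ∀ a b → ent (suc (suc a)) b ≡ (zig ▷ P) a b
P-ode a b = proj₁ (diagonal (a + b) a b refl)

Q-ode : ∀ a b → ent b (suc (suc a)) ≡ (zig ▷ Q) a b
Q-ode a b = proj₂ (diagonal (a + b) a b refl)

-- The equation z'' = z z', the derivative of 2z' = z² + 1 known for tan + sec, is the restriction
-- of `P-ode` to y = 0.
zig-ode : ∀ n → zig (suc (suc n)) ≡ (zig ⋆ (zig ∘ suc)) n
zig-ode n = trans (P-ode n 0) (▷-0 zig P n)

G : ℕ → ℕ → ℕ
G a b = ent b a

-- Both sides W satisfy ∂x W = z'(x+y) Q + z(x+y) W: on the left by differentiating ∂x Q = z(x+y) Q
-- in y, on the right by z'' = z z' and ∂x G = Q. On x = 0 the series G is z, and equality there is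
-- z'' = z' z.
G-ode : ∀ a b → G (suc a) (suc b) ≡ ((zig ∘ suc) ▷ G) a b
G-ode = linear-unique zig ((zig ∘ suc) ▷ Q) row₀ lhs rhs
  where
  open ≡-Reasoning
  row₀ : ∀ b → ent (suc b) 1 ≡ ((zig ∘ suc) ⋆ zig) b
  row₀ b = begin
    ent (suc b) 1           ≡⟨ zig-suc-suc b ⟨
    zig (suc (suc b))       ≡⟨ zig-ode b ⟩
    (zig ⋆ (zig ∘ suc)) b   ≡⟨ ⋆-comm zig (zig ∘ suc) b ⟩
    ((zig ∘ suc) ⋆ zig) b   ∎
  lhs : ∀ a b → ent (suc b) (suc (suc a)) ≡ ((zig ∘ suc) ▷ Q) a b + (zig ▷ ∂y Q) a b
  lhs a b = trans (Q-ode a (suc b)) (▷-∂y zig Q a b)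
  rhs : ∀ a b → ∂x ((zig ∘ suc) ▷ G) a b ≡ ((zig ∘ suc) ▷ Q) a b + (zig ▷ ((zig ∘ suc) ▷ G)) a b
  rhs a b = begin
    ((zig ∘ suc ∘ suc) ▷ G) a b + ((zig ∘ suc) ▷ Q) a b
      ≡⟨ +-comm (((zig ∘ suc ∘ suc) ▷ G) a b) _ ⟩
    ((zig ∘ suc) ▷ Q) a b + ((zig ∘ suc ∘ suc) ▷ G) a b
      ≡⟨ cong (((zig ∘ suc) ▷ Q) a b +_) (▷-congˡ G zig-ode a b) ⟩
    ((zig ∘ suc) ▷ Q) a b + ((zig ⋆ (zig ∘ suc)) ▷ G) a b
      ≡⟨ cong (((zig ∘ suc) ▷ Q) a b +_) (⋆-▷-assoc zig (zig ∘ suc) G a b) ⟩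
    ((zig ∘ suc) ▷ Q) a b + (zig ▷ ((zig ∘ suc) ▷ G)) a b ∎

-- Tangent and secant numbers

module TangentSecant where
  open ℤ using (ℤ; +_; -_)
  import Data.Integer.Properties as ℤ
  open import Data.Integer.Tactic.RingSolver using (solve-∀)

  Σ< : ℕ → (ℕ → ℤ) → ℤ
  Σ< n f = sumℤ (applyUpTo f n)

  Σ<-cong : ∀ n {f g} → (∀ {k} → k < n → f k ≡ g k) → Σ< n f ≡ Σ< n g
  Σ<-cong zero    f≗g = refl
  Σ<-cong (suc n) f≗g = cong₂ ℤ._+_ (f≗g (s≤s z≤n)) (Σ<-cong n (f≗g ∘ s≤s))

  Σ<-+ : ∀ n f g → Σ< n (λ k → f k ℤ.+ g k) ≡ Σ< n f ℤ.+ Σ< n g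
  Σ<-+ zero    f g = refl
  Σ<-+ (suc n) f g = trans (cong (ℤ._+_ (f 0 ℤ.+ g 0)) (Σ<-+ n (f ∘ suc) (g ∘ suc)))
    (solve-+ (f 0) (g 0) _ _)
    where
    solve-+ : ∀ a b c d → (a ℤ.+ b) ℤ.+ (c ℤ.+ d) ≡ (a ℤ.+ c) ℤ.+ (b ℤ.+ d)
    solve-+ = solve-∀

  Σ<-suc : ∀ n f → Σ< (suc n) f ≡ Σ< n f ℤ.+ f n
  Σ<-suc zero    f = ℤ.+-comm (f 0) _
  Σ<-suc (suc n) f = trans (cong (ℤ._+_ (f 0)) (Σ<-suc n (f ∘ suc)))
                           (sym (ℤ.+-assoc (f 0) _ _))

  -- Leibniz' rule again, over ℤ and for a summand that need not be a product.
  bin : ℕ → (ℕ → ℕ → ℤ) → ℤ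
  bin zero    φ = φ 0 0
  bin (suc d) φ = bin d (λ k i → φ (suc k) i) ℤ.+ bin d (λ k i → φ k (suc i))

  bin≡Σ< : ∀ d φ → bin d φ ≡ Σ< (suc d) (λ k → + (d C k) ℤ.* φ k (d ∸ k))
  bin≡Σ< zero    φ = sym (trans (ℤ.+-identityʳ _) (ℤ.*-identityˡ (φ 0 0)))
  bin≡Σ< (suc d) φ = begin
    bin d (λ k i → φ (suc k) i) ℤ.+ bin d (λ k i → φ k (suc i))
      ≡⟨ cong₂ ℤ._+_ (bin≡Σ< d _) (bin≡Σ< d _) ⟩
    Σ< (suc d) shifted ℤ.+ (+ (d C 0) ℤ.* φ 0 (suc d) ℤ.+ Σ< d (λ k → + (d C suc k) ℤ.* φ (suc k) (suc (d ∸ suc k))))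
      ≡⟨ cong (λ t → Σ< (suc d) shifted ℤ.+ (first ℤ.+ t))
           (trans (Σ<-cong d λ {k} k<d → cong (λ e → + (d C suc k) ℤ.* φ (suc k) e) (sym (+-∸-assoc 1 k<d))) (sym drop-last)) ⟩
    Σ< (suc d) shifted ℤ.+ (first ℤ.+ Σ< (suc d) unshifted)
      ≡⟨ rotate (Σ< (suc d) shifted) first (Σ< (suc d) unshifted) ⟩
    first ℤ.+ (Σ< (suc d) shifted ℤ.+ Σ< (suc d) unshifted)
      ≡⟨ cong (ℤ._+_ first) (Σ<-+ (suc d) shifted unshifted) ⟨
    first ℤ.+ Σ< (suc d) (λ k → shifted k ℤ.+ unshifted k)
      ≡⟨ cong (ℤ._+_ first) (Σ<-cong (suc d) λ {k} _ → pascal k) ⟩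
    first ℤ.+ Σ< (suc d) (λ k → + (suc d C suc k) ℤ.* φ (suc k) (d ∸ k)) ∎
    where
    open ≡-Reasoning
    shifted unshifted : ℕ → ℤ
    shifted   k = + (d C k) ℤ.* φ (suc k) (d ∸ k)
    unshifted k = + (d C suc k) ℤ.* φ (suc k) (d ∸ k)
    first = + (d C 0) ℤ.* φ 0 (suc d)
    rotate : ∀ a b c → a ℤ.+ (b ℤ.+ c) ≡ b ℤ.+ (a ℤ.+ c)
    rotate = solve-∀
    pascal : ∀ k → shifted k ℤ.+ unshifted k ≡ + (suc d C suc k) ℤ.* φ (suc k) (d ∸ k)
    pascal k = trans (sym (ℤ.*-distribʳ-+ (φ (suc k) (d ∸ k)) (+ (d C k)) (+ (d C suc k))))
      (cong (λ e → + e ℤ.* φ (suc k) (d ∸ k)) (nCk+nC[k+1]≡[n+1]C[k+1] d k))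
    -- The extra term has coefficient C(d, d+1) = 0; with it both sums have the same range, and
    -- Pascal's rule applies term by term.
    drop-last : Σ< (suc d) unshifted ≡ Σ< d unshifted
    drop-last = begin
      Σ< (suc d) unshifted
        ≡⟨ Σ<-suc d unshifted ⟩
      Σ< d unshifted ℤ.+ + (d C suc d) ℤ.* φ (suc d) (d ∸ d)
        ≡⟨ cong (λ e → Σ< d unshifted ℤ.+ + e ℤ.* φ (suc d) (d ∸ d)) (k>n⇒nCk≡0 (n<1+n d)) ⟩
      Σ< d unshifted ℤ.+ + 0 ℤ.* φ (suc d) (d ∸ d)
        ≡⟨ ℤ.+-identityʳ _ ⟩
      Σ< d unshifted ∎

  -- Each step down in d raises either k or i by one, so d steps reach every final pair (k, d - k)
  -- with its binomial weight.
  bin-unfold : ∀ d (T : ℕ → ℕ → ℕ → ℤ) →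
    (∀ d k i → T (suc d) k i ≡ T d (suc k) i ℤ.+ T d k (suc i)) → T d 0 0 ≡ bin d (T 0)
  bin-unfold zero    T T-rec = refl
  bin-unfold (suc d) T T-rec = trans (T-rec d 0 0) (cong₂ ℤ._+_
    (bin-unfold d (λ d k i → T d (suc k) i) (λ d k i → T-rec d (suc k) i))
    (bin-unfold d (λ d k i → T d k (suc i)) (λ d k i → T-rec d k (suc i))))

  cos-suc : ∀ j → cosCoeff (suc j) ≡ - sinCoeff j
  sin-suc : ∀ j → sinCoeff (suc j) ≡ cosCoeff j
  cos-suc zero    = refl
  cos-suc (suc j) = cong -_ (sym (sin-suc j))
  sin-suc zero    = refl
  sin-suc (suc j) = sym (cos-suc j)

  δ₀ : ℕ → ℤ
  δ₀ zero    = + 1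
  δ₀ (suc _) = + 0

  -- Up to the last term, which only corrects the boundary value ent 0 0 = 1, this is
  -- the rotation by j quarter turns of the pair (ent k d, ent d k); the
  -- Seidel relation ent-suc makes differencing in d such a quarter turn.
  rotated : ℕ → ℕ → ℕ → ℤ
  rotated d k j = cosCoeff j ℤ.* + ent k d ℤ.- sinCoeff j ℤ.* + ent d k ℤ.+ sinCoeff (d + j) ℤ.* δ₀ k

  -- `ent-suc` splits `ent (suc d) k` and, with the indices exchanged, merges `ent k (suc d)` and
  -- `ent d k` into `ent (suc k) d`. The multiple of `ent d k` added for this merger is removed by
  -- the second summand, since cos' = -sin and sin' = cos.
  rotated-rec : ∀ d k j → rotated (suc d) k j ≡ rotated d (suc k) j ℤ.+ rotated d k (suc j)
  rotated-rec d k j = begin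
    cosCoeff j ℤ.* + ent k (suc d) ℤ.- sinCoeff j ℤ.* + ent (suc d) k ℤ.+ sinCoeff (suc d + j) ℤ.* δ₀ k
      ≡⟨ cong (λ e → cosCoeff j ℤ.* + ent k (suc d) ℤ.- sinCoeff j ℤ.* + e ℤ.+ sinCoeff (suc d + j) ℤ.* δ₀ k) (ent-suc d k) ⟩
    cosCoeff j ℤ.* + ent k (suc d) ℤ.- sinCoeff j ℤ.* (+ ent d (suc k) ℤ.+ + ent k d) ℤ.+ sinCoeff (suc d + j) ℤ.* δ₀ k
      ≡⟨ algebra (cosCoeff j) (sinCoeff j) (+ ent k (suc d)) (+ ent d k) (+ ent d (suc k)) (+ ent k d)
           (sinCoeff (suc d + j) ℤ.* δ₀ k) (sinCoeff (d + j)) ⟩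
    (cosCoeff j ℤ.* (+ ent k (suc d) ℤ.+ + ent d k) ℤ.- sinCoeff j ℤ.* + ent d (suc k) ℤ.+ sinCoeff (d + j) ℤ.* + 0)
      ℤ.+ ((- sinCoeff j) ℤ.* + ent k d ℤ.- cosCoeff j ℤ.* + ent d k ℤ.+ sinCoeff (suc d + j) ℤ.* δ₀ k)
      ≡⟨ cong₂ ℤ._+_
           (cong (λ e → cosCoeff j ℤ.* + e ℤ.- sinCoeff j ℤ.* + ent d (suc k) ℤ.+ sinCoeff (d + j) ℤ.* + 0) (sym (ent-suc k d)))
           (cong₂ ℤ._+_ (cong₂ (λ c s → c ℤ.* + ent k d ℤ.- s ℤ.* + ent d k) (sym (cos-suc j)) (sym (sin-suc j)))
             (cong (λ n → sinCoeff n ℤ.* δ₀ k) (sym (+-suc d j)))) ⟩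
    rotated d (suc k) j ℤ.+ rotated d k (suc j) ∎
    where
    open ≡-Reasoning
    algebra : ∀ c s w x y z t u → c ℤ.* w ℤ.- s ℤ.* (y ℤ.+ z) ℤ.+ t ≡ (c ℤ.* (w ℤ.+ x) ℤ.- s ℤ.* y ℤ.+ u ℤ.* + 0) ℤ.+ ((- s) ℤ.* z ℤ.- c ℤ.* x ℤ.+ t)
    algebra = solve-∀

  -- For k > 0 the sine term vanishes because `ent 0 k` does. For k = 0 it is `ent 0 0 = 1` times
  -- the sine coefficient, and the correction term cancels it.
  rotated-0 : ∀ k j → rotated 0 k j ≡ cosCoeff j ℤ.* + zig k
  rotated-0 zero j = algebra (cosCoeff j) (sinCoeff j)
    where
    algebra : ∀ c s → c ℤ.* + 1 ℤ.- s ℤ.* + 1 ℤ.+ s ℤ.* + 1 ≡ c ℤ.* + 1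
    algebra = solve-∀
  rotated-0 (suc k) j = algebra (cosCoeff j) (sinCoeff j) (+ zig (suc k))
    where
    algebra : ∀ c s z → c ℤ.* z ℤ.- s ℤ.* + 0 ℤ.+ s ℤ.* + 0 ≡ c ℤ.* z
    algebra = solve-∀

  bin-cong : ∀ d {φ ψ} → (∀ k i → φ k i ≡ ψ k i) → bin d φ ≡ bin d ψ
  bin-cong zero    eq = eq 0 0
  bin-cong (suc d) eq = cong₂ ℤ._+_ (bin-cong d (λ k i → eq (suc k) i)) (bin-cong d (λ k i → eq k (suc i)))

  term : (ℕ → ℤ) → ℕ → ℕ → ℤ
  term e N k = + (N C k) ℤ.* e k ℤ.* cosCoeff (N ∸ k)

  zigℤ : ℕ → ℤ
  zigℤ n = + zig n

  -- `rotated (suc N) 0 0` is computed twice: unfolded to d = 0 it is the coefficient of z cos,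
  -- while directly only the correction term survives, as `ent 0 (suc N)` and `sinCoeff 0` are 0.
  zig-cos : ∀ N → Σ< (suc (suc N)) (term zigℤ (suc N)) ≡ sinCoeff (suc N)
  zig-cos N = begin
    Σ< (suc (suc N)) (term zigℤ (suc N))
      ≡⟨ Σ<-cong (suc (suc N)) (λ {k} _ → reassoc (+ (suc N C k)) (zigℤ k) (cosCoeff (suc N ∸ k))) ⟩
    Σ< (suc (suc N)) (λ k → + (suc N C k) ℤ.* (cosCoeff (suc N ∸ k) ℤ.* zigℤ k))
      ≡⟨ bin≡Σ< (suc N) (λ k j → cosCoeff j ℤ.* zigℤ k) ⟨
    bin (suc N) (λ k j → cosCoeff j ℤ.* zigℤ k)
      ≡⟨ bin-cong (suc N) rotated-0 ⟨
    bin (suc N) (rotated 0)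
      ≡⟨ bin-unfold (suc N) rotated rotated-rec ⟨
    rotated (suc N) 0 0
      ≡⟨ simplify (sinCoeff (suc N + 0)) (+ zig (suc N)) ⟩
    sinCoeff (suc N + 0)
      ≡⟨ cong sinCoeff (+-identityʳ (suc N)) ⟩
    sinCoeff (suc N) ∎
    where
    open ≡-Reasoning
    reassoc : ∀ a b c → a ℤ.* b ℤ.* c ≡ a ℤ.* (c ℤ.* b)
    reassoc = solve-∀
    simplify : ∀ s e → + 1 ℤ.* + 0 ℤ.- + 0 ℤ.* e ℤ.+ s ℤ.* + 1 ≡ s
    simplify = solve-∀

  zig-rec : ∀ N → zigℤ (suc N) ≡ sinCoeff (suc N) ℤ.- Σ< (suc N) (term zigℤ (suc N))
  zig-rec N = begin
    zigℤ (suc N)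
      ≡⟨ isolate (zigℤ (suc N)) (Σ< (suc N) (term zigℤ (suc N))) ⟩
    Σ< (suc N) (term zigℤ (suc N)) ℤ.+ + 1 ℤ.* zigℤ (suc N) ℤ.* + 1 ℤ.- Σ< (suc N) (term zigℤ (suc N))
      ≡⟨ cong₂ (λ b j → Σ< (suc N) (term zigℤ (suc N)) ℤ.+ + b ℤ.* zigℤ (suc N) ℤ.* cosCoeff j ℤ.- Σ< (suc N) (term zigℤ (suc N)))
           (nCn≡1 (suc N)) (n∸n≡0 N) ⟨
    Σ< (suc N) (term zigℤ (suc N)) ℤ.+ term zigℤ (suc N) (suc N) ℤ.- Σ< (suc N) (term zigℤ (suc N))
      ≡⟨ cong (ℤ._- Σ< (suc N) (term zigℤ (suc N))) (Σ<-suc (suc N) (term zigℤ (suc N))) ⟨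
    Σ< (suc (suc N)) (term zigℤ (suc N)) ℤ.- Σ< (suc N) (term zigℤ (suc N))
      ≡⟨ cong (ℤ._- Σ< (suc N) (term zigℤ (suc N))) (zig-cos N) ⟩
    sinCoeff (suc N) ℤ.- Σ< (suc N) (term zigℤ (suc N)) ∎
    where
    open ≡-Reasoning
    isolate : ∀ z s → z ≡ s ℤ.+ + 1 ℤ.* z ℤ.* + 1 ℤ.- s
    isolate = solve-∀

  length-table : ∀ N → length (tanSecTable N) ≡ suc N
  length-table zero    = refl
  length-table (suc N) = trans (length-++ (tanSecTable N))
    (trans (+-comm _ 1) (cong suc (length-table N)))

  nth-++ˡ : ∀ k xs ys → k < length xs → nth k (xs ++ ys) ≡ nth k xs
  nth-++ˡ zero    (x ∷ xs) ys _       = refl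
  nth-++ˡ (suc k) (x ∷ xs) ys (s≤s p) = nth-++ˡ k xs ys p

  nth-length : ∀ xs y → nth (length xs) (xs ++ y ∷ []) ≡ y
  nth-length []       y = refl
  nth-length (x ∷ xs) y = nth-length xs y

  nth-table : ∀ N k → k ≤ N → nth k (tanSecTable N) ≡ zigℤ k
  nth-table zero    zero _ = refl
  nth-table (suc N) k k≤1+N with m≤n⇒m<n∨m≡n k≤1+N
  ... | inj₁ (s≤s k≤N) = trans
    (nth-++ˡ k (tanSecTable N) _ (subst (k <_) (sym (length-table N)) (s≤s k≤N)))
    (nth-table N k k≤N)
  ... | inj₂ refl = begin
    nth (suc N) (tanSecTable (suc N))
      ≡⟨ cong (λ n → nth n (tanSecTable (suc N))) (length-table N) ⟨
    nth (length (tanSecTable N)) (tanSecTable (suc N))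
      ≡⟨ nth-length (tanSecTable N) _ ⟩
    sinCoeff (suc N) ℤ.- sumℤ (map (term (λ k → nth k (tanSecTable N)) (suc N)) (upTo (suc N)))
      ≡⟨ cong (λ l → sinCoeff (suc N) ℤ.- sumℤ l) (map-upTo (term (λ i → nth i (tanSecTable N)) (suc N)) (suc N)) ⟩
    sinCoeff (suc N) ℤ.- Σ< (suc N) (term (λ k → nth k (tanSecTable N)) (suc N))
      ≡⟨ cong (ℤ._-_ (sinCoeff (suc N))) (Σ<-cong (suc N) λ {k} k<1+N →
           cong (λ e → + (suc N C k) ℤ.* e ℤ.* cosCoeff (suc N ∸ k)) (nth-table N k (≤-pred k<1+N))) ⟩
    sinCoeff (suc N) ℤ.- Σ< (suc N) (term zigℤ (suc N))
      ≡⟨ zig-rec N ⟨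
    zigℤ (suc N) ∎
    where open ≡-Reasoning

  E≡zig : ∀ n → E n ≡ + zig n
  E≡zig n = nth-table n n ≤-refl

-- Enumeration of André permutations

splits : Word → (Word → Word → List Word) → List Word
splits []       f = f [] []
splits (x ∷ xs) f = splits xs (λ as bs → f (x ∷ as) bs) ++ splits xs (λ as bs → f as (x ∷ bs))

∈-splits⁺ : ∀ {as bs xs} (f : Word → Word → List Word) {w} → Interleaving as bs xs → w ∈ f as bs → w ∈ splits xs f
∈-splits⁺ f []        w∈ = w∈
∈-splits⁺ f (consˡ i) w∈ = ∈-++⁺ˡ (∈-splits⁺ _ i w∈)
∈-splits⁺ {xs = x ∷ xs} f (consʳ i) w∈ = ∈-++⁺ʳ (splits xs λ as bs → f (x ∷ as) bs) (∈-splits⁺ _ i w∈)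

∈-splits⁻ : ∀ xs (f : Word → Word → List Word) {w} → w ∈ splits xs f → ∃₂ λ as bs → Interleaving as bs xs × w ∈ f as bs
∈-splits⁻ []       f w∈ = [] , [] , [] , w∈
∈-splits⁻ (x ∷ xs) f w∈ with ∈-++⁻ (splits xs _) w∈
... | inj₁ w∈ˡ = let as , bs , i , w∈f = ∈-splits⁻ xs _ w∈ˡ in x ∷ as , bs , consˡ i , w∈f
... | inj₂ w∈ʳ = let as , bs , i , w∈f = ∈-splits⁻ xs _ w∈ʳ in as , x ∷ bs , consʳ i , w∈f

interleaving-⊆ˡ : ∀ {as bs xs : Word} → Interleaving as bs xs → as ⊆ xs
interleaving-⊆ˡ []        = []
interleaving-⊆ˡ (consˡ i) = refl ∷ interleaving-⊆ˡ i
interleaving-⊆ˡ (consʳ i) = _ ∷ʳ interleaving-⊆ˡ i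

interleaving-⊆ʳ : ∀ {as bs xs : Word} → Interleaving as bs xs → bs ⊆ xs
interleaving-⊆ʳ = interleaving-⊆ˡ ∘ swap

-- This passes from the factors of a given word to the sorted subwords over which the enumeration
-- runs. The first letter of `xs` lies in one of the factors, and deleting it there leaves the same
-- problem for the tail.
↭-interleaving : ∀ (xs v v' : Word) → v ++ v' ↭ xs →
  ∃₂ λ as bs → Interleaving as bs xs × v ↭ as × v' ↭ bs
↭-interleaving [] v v' p = [] , [] , [] ,
  ↭-reflexive (++-conicalˡ v v' (↭-empty-inv p)) , ↭-reflexive (++-conicalʳ v v' (↭-empty-inv p))
↭-interleaving (x ∷ xs) v v' p with ∈-++⁻ v (∈-resp-↭ (↭-sym p) (here refl))
... | inj₁ x∈v with v₁ , v₂ , refl ← ∈-∃++ x∈v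
  with as , bs , i , q , q' ← ↭-interleaving xs (v₁ ++ v₂) v'
         (subst (_↭ xs) (sym (++-assoc v₁ v₂ v')) (drop-mid v₁ [] (subst (_↭ x ∷ xs) (++-assoc v₁ (x ∷ v₂) v') p)))
  = x ∷ as , bs , consˡ i , ↭-trans (shift x v₁ v₂) (prep x q) , q'
... | inj₂ x∈v' with v₁ , v₂ , refl ← ∈-∃++ x∈v'
  with as , bs , i , q , q' ← ↭-interleaving xs v (v₁ ++ v₂)
         (subst (_↭ xs) (++-assoc v v₁ v₂) (drop-mid (v ++ v₁) [] (subst (_↭ x ∷ xs) (sym (++-assoc v v₁ (x ∷ v₂))) p)))
  = as , x ∷ bs , consʳ i , q , ↭-trans (shift x v₁ v₂) (prep x q')

-- β recovers the left part of the split from a word.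
splits-unique : ∀ xs (f : Word → Word → List Word) (β : Word → Word) →
  (∀ {as bs} → Interleaving as bs xs → Unique (f as bs)) →
  (∀ {as bs w y} → Interleaving as bs xs → w ∈ f as bs → y ∈ as → y ∈ β w) →
  (∀ {as bs w y} → Interleaving as bs xs → w ∈ f as bs → y ∈ bs → y ∉ β w) →
  Unique (splits xs f)
splits-unique []       f β f-unique _ _ = f-unique []
splits-unique (x ∷ xs) f β f-unique inˡ inʳ = Unique.++⁺
  (splits-unique xs _ β (f-unique ∘ consˡ) (λ i w∈ → inˡ (consˡ i) w∈ ∘ there) (inʳ ∘ consˡ))
  (splits-unique xs _ β (f-unique ∘ consʳ) (inˡ ∘ consʳ) (λ i w∈ → inʳ (consʳ i) w∈ ∘ there))
  λ (w∈ˡ , w∈ʳ) →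
    let _ , _ , i , w∈f  = ∈-splits⁻ xs _ w∈ˡ
        _ , _ , j , w∈f' = ∈-splits⁻ xs _ w∈ʳ
    in inʳ (consʳ j) w∈f' (here refl) (inˡ (consˡ i) w∈f (here refl))

joins : ℕ → List Word → List Word → List Word
joins x = cartesianProductWith (λ v v' → v ++ x ∷ v')

∈-joins⁻ : ∀ x vs vs' {w} → w ∈ joins x vs vs' →
  ∃₂ λ v v' → v ∈ vs × v' ∈ vs' × w ≡ v ++ x ∷ v'
∈-joins⁻ x = ∈-cartesianProductWith⁻ (λ v v' → v ++ x ∷ v')

before : ℕ → Word → Word
before x []      = []
before x (y ∷ w) with y ≟ x
... | yes _ = []
... | no  _ = y ∷ before x w

before-++ : ∀ {x v} v' → All (_≢ x) v → before x (v ++ x ∷ v') ≡ v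
before-++ {x} v' [] with x ≟ x
... | yes _  = refl
... | no x≢x = contradiction refl x≢x
before-++ {x} {y ∷ v} v' (y≢x ∷ v≢x) with y ≟ x
... | yes y≡x = contradiction y≡x y≢x
... | no  _   = cong (y ∷_) (before-++ v' v≢x)

-- As `x` does not occur in the left factors, `before x` recovers the left factor of a joined word,
-- so the blocks for different `v` are disjoint.
joins-unique : ∀ x vs {vs'} → (∀ {v} → v ∈ vs → All (_≢ x) v) → Unique vs → Unique vs' → Unique (joins x vs vs')
joins-unique x []       _    _                  _   = []
joins-unique x (v ∷ vs) {vs'} ≢x (v≢ ∷ vs-unique) vs'-unique = Unique.++⁺
  (Unique.map⁺ (∷-injectiveʳ ∘ ++-cancelˡ v _ _) vs'-unique)
  (joins-unique x vs (≢x ∘ there) vs-unique vs'-unique)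
  disjoint
  where
  disjoint : ∀ {w} → ¬ (w ∈ map (λ v' → v ++ x ∷ v') vs' × w ∈ joins x vs vs')
  disjoint (w∈ , w∈') with v₁ , _ , refl ← ∈-map⁻ _ w∈
    with v₂ , v₃ , v₂∈ , _ , eq ← ∈-joins⁻ x vs vs' w∈' =
    All.lookup v≢ v₂∈ (trans (sym (before-++ v₁ (≢x (here refl))))
      (trans (cong (before x) eq) (before-++ v₃ (≢x (there v₂∈)))))

Sorted : Word → Set
Sorted = AllPairs _<_

sorted-⊆ : ∀ {xs ys} → xs ⊆ ys → Sorted ys → Sorted xs
sorted-⊆ []         _             = []
sorted-⊆ (_ ∷ʳ p)   (_ ∷ ys)      = sorted-⊆ p ys
sorted-⊆ (refl ∷ p) (y< ∷ ys)     = ⊆.All-resp-⊆ p y< ∷ sorted-⊆ p ys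

disjoint : ∀ {as bs xs y} → Interleaving as bs xs → Sorted xs → y ∈ as → y ∉ bs
disjoint (consˡ i) (_ ∷ xs)  (there y∈) y∈'         = disjoint i xs y∈ y∈'
disjoint (consˡ i) (x< ∷ xs) (here refl) y∈'        = <-irrefl refl (All.lookup (⊆.All-resp-⊆ (interleaving-⊆ʳ i) x<) y∈')
disjoint (consʳ i) (_ ∷ xs)  y∈ (there y∈')         = disjoint i xs y∈ y∈'
disjoint (consʳ i) (x< ∷ xs) y∈ (here refl)         = <-irrefl refl (All.lookup (⊆.All-resp-⊆ (interleaving-⊆ˡ i) x<) y∈)

root-≢ : ∀ {x xs ys v} → All (x <_) xs → ys ⊆ xs → v ↭ ys → All (_≢ x) v
root-≢ x< p q = All-resp-↭ (↭-sym q) (⊆.All-resp-⊆ p (All.map >⇒≢ x<))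

-- The two kinds of André permutations differ in which letter s of vv' is
-- required to lie in v': put inserts that letter into a sorted word, take
-- extracts it.
record Kind : Set₁ where
  field
    put         : ℕ → Word → Word
    take        : Word → Maybe (ℕ × Word)
    take-[]     : take [] ≡ nothing
    take-put    : ∀ s xs → take (put s xs) ≡ just (s , xs)
    view        : ∀ xs → xs ≡ [] ⊎ ∃₂ λ s ys → xs ≡ put s ys
    put-↭       : ∀ s xs → put s xs ↭ s ∷ xs
    put-⊆       : ∀ {s xs ys} → xs ⊆ ys → put s xs ⊆ put s ys
    ⊆-put       : ∀ s xs → xs ⊆ put s xs
    _≼_         : ℕ → ℕ → Set
    ≼-antisym   : ∀ {x y} → x ≼ y → y ≼ x → x ≡ y
    put-extreme : ∀ {s xs} → Sorted (put s xs) → All (s ≼_) (put s xs)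
    André       : Word → Set
    André-[]    : André []
    André-[-]   : ∀ x → André [ x ]
    André-split : ∀ v x v' → All (x <_) (v ++ v') → André v → André v' →
                  Σ ℕ (λ y → y ∈ v' × All (y ≼_) (v ++ v')) → André (v ++ x ∷ v')
    André-view  : ∀ {w} → André w → w ≡ [] ⊎ (∃ λ x → w ≡ [ x ]) ⊎
                  Σ Word λ v → Σ ℕ λ x → Σ Word λ v' → w ≡ v ++ x ∷ v' × All (x <_) (v ++ v') × André v × André v' ×
                  Σ ℕ (λ y → y ∈ v' × All (y ≼_) (v ++ v'))

module Enumeration (K : Kind) where
  open Kind K

  -- The first argument is fuel: the enumeration is complete once it is at least
  -- the number of letters.
  words : ℕ → Word → List Word
  branch : ℕ → ℕ → Maybe (ℕ × Word) → List Word
  words k       []       = [ [] ]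
  words zero    (x ∷ xs) = []
  words (suc k) (x ∷ xs) = branch k x (take xs)
  branch k x nothing         = [ [ x ] ]
  -- Only the letters other than `s` are distributed, and `s` is then returned to the right part:
  -- this is the André condition.
  branch k x (just (s , ys)) = splits ys λ as bs → joins x (words k as) (words k (put s bs))

  words-[-] : ∀ k x → words (suc k) [ x ] ≡ [ [ x ] ]
  words-[-] k x = cong (branch k x) take-[]

  words-put : ∀ k x s ys → words (suc k) (x ∷ put s ys) ≡
    splits ys λ as bs → joins x (words k as) (words k (put s bs))
  words-put k x s ys = cong (branch k x) (take-put s ys)

  length-put : ∀ s xs → length (put s xs) ≡ suc (length xs)
  length-put s xs = ↭-length (put-↭ s xs)

  ∈-words-put⁻ : ∀ {k x s ys w} → w ∈ words (suc k) (x ∷ put s ys) →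
    ∃₂ λ as bs → ∃₂ λ v v' → Interleaving as bs ys × v ∈ words k as × v' ∈ words k (put s bs) × w ≡ v ++ x ∷ v'
  ∈-words-put⁻ {k} {x} {s} {ys} w∈
    with as , bs , i , w∈j ← ∈-splits⁻ ys _ (subst (_ ∈_) (words-put k x s ys) w∈)
    with v , v' , v∈ , v'∈ , eq ← ∈-joins⁻ x (words k as) (words k (put s bs)) w∈j
    = as , bs , v , v' , i , v∈ , v'∈ , eq

  put-interleaving-↭ : ∀ {as bs ys v v'} s → Interleaving as bs ys → v ↭ as → v' ↭ put s bs → v ++ v' ↭ put s ys
  put-interleaving-↭ {as} {bs} {ys} {v} {v'} s i v↭ v'↭ = begin
    v ++ v'        ↭⟨ ++⁺ v↭ (↭-trans v'↭ (put-↭ s bs)) ⟩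
    as ++ s ∷ bs   ↭⟨ shift s as bs ⟩
    s ∷ as ++ bs   ↭⟨ prep s (↭-sym (toPermutation i)) ⟩
    s ∷ ys         ↭⟨ put-↭ s ys ⟨
    put s ys       ∎
    where open PermutationReasoning

  words-↭ : ∀ k xs {w} → w ∈ words k xs → w ↭ xs
  words-↭ k       []       (here refl) = ↭-refl
  words-↭ (suc k) (x ∷ xs) w∈ with view xs
  ... | inj₁ refl with here refl ← subst (_ ∈_) (words-[-] k x) w∈ = ↭-refl
  ... | inj₂ (s , ys , refl)
    with as , bs , v , v' , i , v∈ , v'∈ , refl ← ∈-words-put⁻ {k} {x} {s} w∈ =
    ↭-trans (shift x v v') (prep x (put-interleaving-↭ s i (words-↭ k as v∈) (words-↭ k (put s bs) v'∈)))

  words-sound : ∀ k xs {w} → Sorted xs → w ∈ words k xs → André w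
  words-sound k       []       _  (here refl) = André-[]
  words-sound (suc k) (x ∷ xs) (x< ∷ xs-sorted) w∈ with view xs
  ... | inj₁ refl with here refl ← subst (_ ∈_) (words-[-] k x) w∈ = André-[-] x
  ... | inj₂ (s , ys , refl)
    with as , bs , v , v' , i , v∈ , v'∈ , refl ← ∈-words-put⁻ {k} {x} {s} w∈ =
    André-split v x v' (All-resp-↭ (↭-sym v++v'↭) x<)
      (words-sound k as (sorted-⊆ as⊆ xs-sorted) v∈)
      (words-sound k (put s bs) (sorted-⊆ (put-⊆ (interleaving-⊆ʳ i)) xs-sorted) v'∈)
      (s , ∈-resp-↭ (↭-sym (↭-trans (words-↭ k (put s bs) v'∈) (put-↭ s bs))) (here refl)
         , All-resp-↭ (↭-sym v++v'↭) (put-extreme xs-sorted))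
    where
    v++v'↭ = put-interleaving-↭ s i (words-↭ k as v∈) (words-↭ k (put s bs) v'∈)
    as⊆ = ⊆-trans (interleaving-⊆ˡ i) (⊆-put s ys)

  fuel-left : ∀ {k s as bs ys} → length (put s ys) ≤ k → Interleaving as bs ys → length as ≤ k
  fuel-left {s = s} {ys = ys} ≤k i =
    ≤-trans (⊆.length-mono-≤ (⊆-trans (interleaving-⊆ˡ i) (⊆-put s ys))) ≤k

  fuel-right : ∀ {k s as bs ys} → length (put s ys) ≤ k → Interleaving as bs ys → length (put s bs) ≤ k
  fuel-right ≤k i = ≤-trans (⊆.length-mono-≤ (put-⊆ (interleaving-⊆ʳ i))) ≤k

  root-minimal : ∀ {x x₀ us xs} → All (x <_) us → All (x₀ <_) xs → x ∷ us ↭ x₀ ∷ xs → x ≡ x₀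
  root-minimal x< x₀< p with ∈-resp-↭ (↭-sym p) (here refl) | ∈-resp-↭ p (here refl)
  ... | here x₀≡x  | _           = sym x₀≡x
  ... | there _    | here x≡x₀   = x≡x₀
  ... | there x₀∈  | there x∈    = contradiction (All.lookup x₀< x∈) (<-asym (All.lookup x< x₀∈))

  words-complete : ∀ k xs {w} → length xs ≤ k → Sorted xs → w ↭ xs → André w → w ∈ words k xs
  words-complete k [] _ _ w↭ _ = here (↭-empty-inv w↭)
  words-complete (suc k) (x₀ ∷ xs) (s≤s ≤k) (x₀< ∷ xs-sorted) w↭ w-andré with André-view w-andré
  ... | inj₁ refl = contradiction (↭-sym w↭) ¬x∷xs↭[]
  ... | inj₂ (inj₁ (x , refl)) with refl ← ↭-singleton-inv (↭-sym w↭) =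
    subst (_ ∈_) (sym (words-[-] k x)) (here refl)
  ... | inj₂ (inj₂ (v , x , v' , refl , x< , v-andré , v'-andré , y , y∈v' , y≼))
    with refl ← root-minimal x< x₀< (↭-trans (↭-sym (shift x v v')) w↭)
    with v++v'↭xs ← drop-mid v [] w↭
    with view xs
  ... | inj₁ refl with () ← subst (y ∈_) (++-conicalʳ v v' (↭-empty-inv v++v'↭xs)) y∈v'
  ... | inj₂ (s , ys , refl)
    with v++v'↭ ← ↭-trans v++v'↭xs (put-↭ s ys)
    -- The letter `y` of the André condition and the letter `s` set aside by the enumeration are
    -- both extreme among the non-root letters, hence equal.
    with refl ← ≼-antisym (All.lookup y≼ (∈-resp-↭ (↭-sym v++v'↭) (here refl)))
                  (All.lookup (put-extreme xs-sorted) (∈-resp-↭ v++v'↭xs (∈-++⁺ʳ v y∈v')))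
    with v₁ , v₂ , refl ← ∈-∃++ y∈v'
    with as , bs , i , v↭ , v₁++v₂↭ ← ↭-interleaving ys v (v₁ ++ v₂) (subst (_↭ ys) (++-assoc v v₁ v₂)
           (drop-mid (v ++ v₁) [] (subst (_↭ s ∷ ys) (sym (++-assoc v v₁ (s ∷ v₂))) v++v'↭)))
    = subst (_ ∈_) (sym (words-put k x s ys)) (∈-splits⁺ _ i (∈-cartesianProductWith⁺ _
        (words-complete k as (fuel-left ≤k i) (sorted-⊆ (⊆-trans (interleaving-⊆ˡ i) (⊆-put s ys)) xs-sorted) v↭ v-andré)
        (words-complete k (put s bs) (fuel-right ≤k i) (sorted-⊆ (put-⊆ (interleaving-⊆ʳ i)) xs-sorted)
          (↭-trans (shift s v₁ v₂) (↭-trans (prep s v₁++v₂↭) (↭-sym (put-↭ s bs)))) v'-andré)))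

  words-unique : ∀ k xs → Sorted xs → Unique (words k xs)
  words-unique k       []       _ = [] ∷ []
  words-unique zero    (x ∷ xs) _ = []
  words-unique (suc k) (x ∷ xs) (x< ∷ xs-sorted) with view xs
  ... | inj₁ refl = subst Unique (sym (words-[-] k x)) ([] ∷ [])
  ... | inj₂ (s , ys , refl) = subst Unique (sym (words-put k x s ys))
    (splits-unique ys _ (before x) unique-joins inˡ inʳ)
    where
    left-⊆ : ∀ {as bs} → Interleaving as bs ys → as ⊆ put s ys
    left-⊆ i = ⊆-trans (interleaving-⊆ˡ i) (⊆-put s ys)
    left-≢ : ∀ {as bs v} → Interleaving as bs ys → v ∈ words k as → All (_≢ x) v
    left-≢ i v∈ = root-≢ x< (left-⊆ i) (words-↭ k _ v∈)
    unique-joins : ∀ {as bs} → Interleaving as bs ys → Unique (joins x (words k as) (words k (put s bs)))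
    unique-joins i = joins-unique x _ (left-≢ i)
      (words-unique k _ (sorted-⊆ (left-⊆ i) xs-sorted))
      (words-unique k _ (sorted-⊆ (put-⊆ (interleaving-⊆ʳ i)) xs-sorted))
    before-↭ : ∀ {as bs w} → Interleaving as bs ys → w ∈ joins x (words k as) (words k (put s bs)) → before x w ↭ as
    before-↭ {as} {bs} i w∈ with v , v' , v∈ , _ , refl ← ∈-joins⁻ x (words k as) (words k (put s bs)) w∈ =
      subst (_↭ _) (sym (before-++ v' (left-≢ i v∈))) (words-↭ k _ v∈)
    inˡ : ∀ {as bs w y} → Interleaving as bs ys → w ∈ joins x (words k as) (words k (put s bs)) → y ∈ as → y ∈ before x w
    inˡ {as} {bs} i w∈ y∈as = ∈-resp-↭ (↭-sym (before-↭ {as} {bs} i w∈)) y∈as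
    inʳ : ∀ {as bs w y} → Interleaving as bs ys → w ∈ joins x (words k as) (words k (put s bs)) → y ∈ bs → y ∉ before x w
    inʳ {as} {bs} i w∈ y∈bs y∈ = disjoint i ys-sorted (∈-resp-↭ (before-↭ {as} {bs} i w∈) y∈) y∈bs
      where ys-sorted = sorted-⊆ (⊆-put s ys) xs-sorted

-- Counting words by a statistic

Σsplits : Word → (Word → Word → ℕ) → ℕ
Σsplits []       φ = φ [] []
Σsplits (x ∷ xs) φ = Σsplits xs (λ as bs → φ (x ∷ as) bs) + Σsplits xs (λ as bs → φ as (x ∷ bs))

Σsplits-cong : ∀ xs {φ ψ} → (∀ {as bs} → Interleaving as bs xs → φ as bs ≡ ψ as bs) → Σsplits xs φ ≡ Σsplits xs ψ
Σsplits-cong []       eq = eq []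
Σsplits-cong (x ∷ xs) eq = cong₂ _+_ (Σsplits-cong xs (eq ∘ consˡ)) (Σsplits-cong xs (eq ∘ consʳ))

Σsplits-zero : ∀ xs {φ} → (∀ {as bs} → Interleaving as bs xs → φ as bs ≡ 0) → Σsplits xs φ ≡ 0
Σsplits-zero []       eq = eq []
Σsplits-zero (x ∷ xs) eq = cong₂ _+_ (Σsplits-zero xs (eq ∘ consˡ)) (Σsplits-zero xs (eq ∘ consʳ))

Σsplits-+ : ∀ xs φ ψ → Σsplits xs (λ as bs → φ as bs + ψ as bs) ≡ Σsplits xs φ + Σsplits xs ψ
Σsplits-+ []       φ ψ = refl
Σsplits-+ (x ∷ xs) φ ψ = trans (cong₂ _+_ (Σsplits-+ xs _ _) (Σsplits-+ xs _ _)) (interchange (Σsplits xs (λ as bs → φ (x ∷ as) bs)) _ _ _)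

Σsplits-flip : ∀ xs φ → Σsplits xs φ ≡ Σsplits xs (λ as bs → φ bs as)
Σsplits-flip []       φ = refl
Σsplits-flip (x ∷ xs) φ = trans (cong₂ _+_ (Σsplits-flip xs _) (Σsplits-flip xs _))
  (+-comm (Σsplits xs (λ as bs → φ (x ∷ bs) as)) _)

Σsplits-⋆ : ∀ xs {φ} f g → (∀ {as bs} → Interleaving as bs xs → φ as bs ≡ f (length as) * g (length bs)) →
  Σsplits xs φ ≡ (f ⋆ g) (length xs)
Σsplits-⋆ []       f g eq = eq []
Σsplits-⋆ (x ∷ xs) f g eq = cong₂ _+_ (Σsplits-⋆ xs (f ∘ suc) g (eq ∘ consˡ)) (Σsplits-⋆ xs f (g ∘ suc) (eq ∘ consʳ))

Σsplits-[]ˡ : ∀ xs {φ} → (∀ {a as bs} → Interleaving (a ∷ as) bs xs → φ (a ∷ as) bs ≡ 0) → Σsplits xs φ ≡ φ [] xs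
Σsplits-[]ˡ []       _  = refl
Σsplits-[]ˡ (x ∷ xs) eq = cong₂ _+_ (Σsplits-zero xs (eq ∘ consˡ)) (Σsplits-[]ˡ xs (eq ∘ consʳ))

Σsplits-[]ʳ : ∀ xs {φ} → (∀ {as b bs} → Interleaving as (b ∷ bs) xs → φ as (b ∷ bs) ≡ 0) → Σsplits xs φ ≡ φ xs []
Σsplits-[]ʳ xs {φ} eq = trans (Σsplits-flip xs φ) (Σsplits-[]ˡ xs (eq ∘ swap))

Σsplits-snoc : ∀ xs n φ → Σsplits (xs ++ [ n ]) φ ≡ Σsplits xs (λ as bs → φ (as ++ [ n ]) bs) + Σsplits xs (λ as bs → φ as (bs ++ [ n ]))
Σsplits-snoc []       n φ = refl
Σsplits-snoc (x ∷ xs) n φ = trans (cong₂ _+_ (Σsplits-snoc xs n _) (Σsplits-snoc xs n _))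
  (interchange (Σsplits xs (λ as bs → φ (x ∷ as ++ [ n ]) bs)) _ _ _)

-- The part without `m` draws on `lo` and `hi` alike and has a weight depending on its length alone,
-- which gives f(x+y). The hypotheses keep only sublist bounds, because fuel, sortedness and
-- avoidance of a letter all pass to sublists.
Σsplits-▷ʳ : ∀ lo {m hi φ} f p →
  (∀ {as l h} → as ⊆ lo ++ hi → l ⊆ lo → h ⊆ hi → φ as (l ++ m ∷ h) ≡ f (length as) * p (length l) (length h)) →
  (∀ {bs l h} → bs ⊆ lo ++ hi → l ⊆ lo → h ⊆ hi → φ (l ++ m ∷ h) bs ≡ 0) →
  Σsplits (lo ++ m ∷ hi) φ ≡ (f ▷ p) (length lo) (length hi)
Σsplits-▷ʳ [] {hi = hi} f p eqʳ eqˡ = cong₂ _+_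
  (Σsplits-zero hi λ i → eqˡ (interleaving-⊆ʳ i) [] (interleaving-⊆ˡ i))
  (Σsplits-⋆ hi f (p 0) λ i → eqʳ (interleaving-⊆ˡ i) [] (interleaving-⊆ʳ i))
Σsplits-▷ʳ (x ∷ lo) f p eqʳ eqˡ = cong₂ _+_
  (Σsplits-▷ʳ lo (f ∘ suc) p (λ a b → eqʳ (refl ∷ a) (x ∷ʳ b)) (λ a b → eqˡ (x ∷ʳ a) (refl ∷ b)))
  (Σsplits-▷ʳ lo f (∂x p) (λ a b → eqʳ (x ∷ʳ a) (refl ∷ b)) (λ a b → eqˡ (refl ∷ a) (x ∷ʳ b)))

Σsplits-▷ˡ : ∀ lo {m hi φ} f p →
  (∀ {bs l h} → bs ⊆ lo ++ hi → l ⊆ lo → h ⊆ hi → φ (l ++ m ∷ h) bs ≡ f (length bs) * p (length l) (length h)) →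
  (∀ {as l h} → as ⊆ lo ++ hi → l ⊆ lo → h ⊆ hi → φ as (l ++ m ∷ h) ≡ 0) →
  Σsplits (lo ++ m ∷ hi) φ ≡ (f ▷ p) (length lo) (length hi)
Σsplits-▷ˡ lo {m} {hi} {φ} f p eqˡ eqʳ = trans (Σsplits-flip (lo ++ m ∷ hi) φ) (Σsplits-▷ʳ lo f p eqˡ eqʳ)

count : (Word → ℕ) → ℕ → List Word → ℕ
count stat m ws = length (filter (λ w → stat w ≟ m) ws)

indicator : ℕ → ℕ → ℕ
indicator a m = if a ≡ᵇ m then 1 else 0

count-∷ : ∀ stat m w ws → count stat m (w ∷ ws) ≡ indicator (stat w) m + count stat m ws
count-∷ stat m w ws with stat w ≡ᵇ m
... | true  = refl
... | false = refl

count-++ : ∀ stat m ws ws' → count stat m (ws ++ ws') ≡ count stat m ws + count stat m ws'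
count-++ stat m ws ws' = trans (cong length (filter-++ (λ w → stat w ≟ m) ws ws')) (length-++ (filter _ ws))

count-none : ∀ {stat m ws} → (∀ {w} → w ∈ ws → stat w ≢ m) → count stat m ws ≡ 0
count-none stat≢m = cong length (filter-none _ (All.tabulate stat≢m))

count-all : ∀ {stat m ws} → (∀ {w} → w ∈ ws → stat w ≡ m) → count stat m ws ≡ length ws
count-all stat≡m = cong length (filter-all _ (All.tabulate stat≡m))

count-cong : ∀ {stat stat'} m ws → (∀ {w} → w ∈ ws → stat w ≡ stat' w) → count stat m ws ≡ count stat' m ws
count-cong m []       _  = refl
count-cong {stat} {stat'} m (w ∷ ws) eq = begin
  count stat m (w ∷ ws)                       ≡⟨ count-∷ stat m w ws ⟩
  indicator (stat w) m + count stat m ws      ≡⟨ cong₂ _+_ (cong (λ a → indicator a m) (eq (here refl))) (count-cong m ws (eq ∘ there)) ⟩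
  indicator (stat' w) m + count stat' m ws    ≡⟨ count-∷ stat' m w ws ⟨
  count stat' m (w ∷ ws)                      ∎
  where open ≡-Reasoning

count-map : ∀ stat (h : Word → Word) m ws → count stat m (map h ws) ≡ count (stat ∘ h) m ws
count-map stat h m []       = refl
count-map stat h m (w ∷ ws) = begin
  count stat m (h w ∷ map h ws)                       ≡⟨ count-∷ stat m (h w) (map h ws) ⟩
  indicator (stat (h w)) m + count stat m (map h ws)  ≡⟨ cong (indicator (stat (h w)) m +_) (count-map stat h m ws) ⟩
  indicator (stat (h w)) m + count (stat ∘ h) m ws    ≡⟨ count-∷ (stat ∘ h) m w ws ⟨
  count (stat ∘ h) m (w ∷ ws)                         ∎
  where open ≡-Reasoning

count-const : ∀ a m (ws : List Word) → count (λ _ → a) m ws ≡ length ws * indicator a m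
count-const a m []       = refl
count-const a m (w ∷ ws) = trans (count-∷ (λ _ → a) m w ws) (cong (indicator a m +_) (count-const a m ws))

count-splits : ∀ stat m xs f → count stat m (splits xs f) ≡ Σsplits xs (λ as bs → count stat m (f as bs))
count-splits stat m []       f = refl
count-splits stat m (x ∷ xs) f = trans (count-++ stat m (splits xs _) _)
  (cong₂ _+_ (count-splits stat m xs _) (count-splits stat m xs _))

length-splits : ∀ xs f → length (splits xs f) ≡ Σsplits xs (λ as bs → length (f as bs))
length-splits []       f = refl
length-splits (x ∷ xs) f = trans (length-++ (splits xs _)) (cong₂ _+_ (length-splits xs _) (length-splits xs _))

length-joins : ∀ x vs vs' → length (joins x vs vs') ≡ length vs * length vs'
length-joins x []       vs' = refl
length-joins x (v ∷ vs) vs' = trans (length-++ (map _ vs')) (cong₂ _+_ (length-map _ vs') (length-joins x vs vs'))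

count-joinsʳ : ∀ {stat x m} stat' vs vs' → (∀ {v v'} → v ∈ vs → v' ∈ vs' → stat (v ++ x ∷ v') ≡ stat' v') →
  count stat m (joins x vs vs') ≡ length vs * count stat' m vs'
count-joinsʳ                stat' []       vs' eq = refl
count-joinsʳ {stat} {x} {m} stat' (v ∷ vs) vs' eq = begin
  count stat m (map (λ v' → v ++ x ∷ v') vs' ++ joins x vs vs')
    ≡⟨ count-++ stat m (map _ vs') _ ⟩
  count stat m (map (λ v' → v ++ x ∷ v') vs') + count stat m (joins x vs vs')
    ≡⟨ cong₂ _+_ (trans (count-map stat _ m vs') (count-cong m vs' (eq (here refl)))) (count-joinsʳ stat' vs vs' (eq ∘ there)) ⟩
  count stat' m vs' + length vs * count stat' m vs' ∎
  where open ≡-Reasoning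

count-joinsˡ : ∀ {stat x m} stat' vs vs' → (∀ {v v'} → v ∈ vs → v' ∈ vs' → stat (v ++ x ∷ v') ≡ stat' v) →
  count stat m (joins x vs vs') ≡ length vs' * count stat' m vs
count-joinsˡ                stat' []       vs' eq = sym (*-zeroʳ (length vs'))
count-joinsˡ {stat} {x} {m} stat' (v ∷ vs) vs' eq = begin
  count stat m (map (λ v' → v ++ x ∷ v') vs' ++ joins x vs vs')
    ≡⟨ count-++ stat m (map _ vs') _ ⟩
  count stat m (map (λ v' → v ++ x ∷ v') vs') + count stat m (joins x vs vs')
    ≡⟨ cong₂ _+_ (trans (count-map stat _ m vs') (trans (count-cong m vs' (eq (here refl))) (count-const (stat' v) m vs')))
                 (count-joinsˡ stat' vs vs' (eq ∘ there)) ⟩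
  length vs' * indicator (stat' v) m + length vs' * count stat' m vs
    ≡⟨ *-distribˡ-+ (length vs') (indicator (stat' v) m) _ ⟨
  length vs' * (indicator (stat' v) m + count stat' m vs)
    ≡⟨ cong (length vs' *_) (count-∷ stat' m v vs) ⟨
  length vs' * count stat' m (v ∷ vs) ∎
  where open ≡-Reasoning

count-joins-none : ∀ {stat x m} vs vs' → (∀ {v v'} → v ∈ vs → v' ∈ vs' → stat (v ++ x ∷ v') ≢ m) →
  count stat m (joins x vs vs') ≡ 0
count-joins-none {stat} {x} {m} vs vs' ≢m = count-none {stat = stat} {ws = joins x vs vs'} ≢
  where
  ≢ : ∀ {w} → w ∈ joins x vs vs' → stat w ≢ m
  ≢ w∈ with _ , _ , v∈ , v'∈ , refl ← ∈-joins⁻ x vs vs' w∈ = ≢m v∈ v'∈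

count-joins-all : ∀ {stat x m} vs vs' → (∀ {v v'} → v ∈ vs → v' ∈ vs' → stat (v ++ x ∷ v') ≡ m) →
  count stat m (joins x vs vs') ≡ length vs * length vs'
count-joins-all {stat} {x} {m} vs vs' ≡m = trans (count-all {stat = stat} {ws = joins x vs vs'} eq) (length-joins x vs vs')
  where
  eq : ∀ {w} → w ∈ joins x vs vs' → stat w ≡ m
  eq w∈ with _ , _ , v∈ , v'∈ , refl ← ∈-joins⁻ x vs vs' w∈ = ≡m v∈ v'∈

module Counting (K : Kind) where
  open Kind K
  open Enumeration K

  words-All : ∀ {Q : ℕ → Set} k xs {v} → All Q xs → v ∈ words k xs → All Q v
  words-All k xs qs v∈ = All-resp-↭ (↭-sym (words-↭ k xs v∈)) qs

  words-length : ∀ k xs {v} → v ∈ words k xs → length v ≡ length xs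
  words-length k xs v∈ = ↭-length (words-↭ k xs v∈)

  -- The right part holds `s` besides `bs`, so the convolution is z z', which `zig-ode` identifies
  -- with z''.
  length-words : ∀ k xs → length xs ≤ k → length (words k xs) ≡ zig (length xs)
  length-words k       []       _ = refl
  length-words (suc k) (x ∷ xs) (s≤s ≤k) with view xs
  ... | inj₁ refl = cong length (words-[-] k x)
  ... | inj₂ (s , ys , refl) = begin
    length (words (suc k) (x ∷ put s ys))
      ≡⟨ cong length (words-put k x s ys) ⟩
    length (splits ys λ as bs → joins x (words k as) (words k (put s bs)))
      ≡⟨ length-splits ys _ ⟩
    Σsplits ys (λ as bs → length (joins x (words k as) (words k (put s bs))))
      ≡⟨ Σsplits-⋆ ys zig (zig ∘ suc) product ⟩
    (zig ⋆ (zig ∘ suc)) (length ys)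
      ≡⟨ zig-ode (length ys) ⟨
    zig (suc (suc (length ys)))
      ≡⟨ cong (zig ∘ suc) (length-put s ys) ⟨
    zig (suc (length (put s ys))) ∎
    where
    open ≡-Reasoning
    product : ∀ {as bs} → Interleaving as bs ys →
      length (joins x (words k as) (words k (put s bs))) ≡ zig (length as) * zig (suc (length bs))
    product {as} {bs} i = trans (length-joins x (words k as) (words k (put s bs))) (cong₂ _*_
      (length-words k as (fuel-left ≤k i))
      (trans (length-words k (put s bs) (fuel-right ≤k i)) (cong zig (length-put s bs))))

  count-words-put : ∀ stat m k x s ys → count stat m (words (suc k) (x ∷ put s ys)) ≡
    Σsplits ys λ as bs → count stat m (joins x (words k as) (words k (put s bs)))
  count-words-put stat m k x s ys =
    trans (cong (count stat m) (words-put k x s ys)) (count-splits stat m ys _)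

-- The two types

snoc : ℕ → Word → Word
snoc s xs = xs ++ [ s ]

unsnoc : Word → Maybe (ℕ × Word)
unsnoc []           = nothing
unsnoc (x ∷ [])     = just (x , [])
unsnoc (x ∷ y ∷ xs) with unsnoc (y ∷ xs)
... | nothing       = nothing
... | just (s , ys) = just (s , x ∷ ys)

unsnoc-snoc : ∀ s xs → unsnoc (snoc s xs) ≡ just (s , xs)
unsnoc-snoc s []           = refl
unsnoc-snoc s (x ∷ [])     = refl
unsnoc-snoc s (x ∷ y ∷ xs) rewrite unsnoc-snoc s (y ∷ xs) = refl

snoc-view : ∀ xs → xs ≡ [] ⊎ ∃₂ λ s ys → xs ≡ snoc s ys
snoc-view []       = inj₁ refl
snoc-view (x ∷ xs) with snoc-view xs
... | inj₁ refl            = inj₂ (x , [] , refl)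
... | inj₂ (s , ys , refl) = inj₂ (s , x ∷ ys , refl)

cons-view : ∀ (xs : Word) → xs ≡ [] ⊎ ∃₂ λ s ys → xs ≡ s ∷ ys
cons-view []       = inj₁ refl
cons-view (x ∷ xs) = inj₂ (x , xs , refl)

snoc-↭ : ∀ s xs → snoc s xs ↭ s ∷ xs
snoc-↭ s xs = ↭-trans (shift s xs []) (prep s (↭-reflexive (++-identityʳ xs)))

snoc-greatest : ∀ {s xs} → Sorted (snoc s xs) → All (_≤ s) (snoc s xs)
snoc-greatest {xs = []}     _                 = ≤-refl ∷ []
snoc-greatest {xs = x ∷ xs} (x< ∷ xs-sorted)  =
  <⇒≤ (All.lookup x< (∈-++⁺ʳ xs (here refl))) ∷ snoc-greatest {xs = xs} xs-sorted

cons-least : ∀ {s xs} → Sorted (s ∷ xs) → All (s ≤_) (s ∷ xs)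
cons-least (s< ∷ _) = ≤-refl ∷ All.map <⇒≤ s<

typeI : Kind
typeI = record
  { put         = snoc
  ; take        = unsnoc
  ; take-[]     = refl
  ; take-put    = unsnoc-snoc
  ; view        = snoc-view
  ; put-↭       = snoc-↭
  ; put-⊆       = λ p → ⊆.++⁺ p ⊆-refl
  ; ⊆-put       = λ s xs → ⊆.++⁺ʳ [ s ] ⊆-refl
  ; _≼_         = λ x y → y ≤ x
  ; ≼-antisym   = λ y≤x x≤y → ≤-antisym x≤y y≤x
  ; put-extreme = snoc-greatest
  ; André       = AndreI
  ; André-[]    = empty
  ; André-[-]   = single
  ; André-split = split
  ; André-view  = λ where
      empty                     → inj₁ refl
      (single x)                → inj₂ (inj₁ (x , refl))
      (split v x v' x< a a' y)  → inj₂ (inj₂ (v , x , v' , refl , x< , a , a' , y))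
  }

typeII : Kind
typeII = record
  { put         = _∷_
  ; take        = uncons
  ; take-[]     = refl
  ; take-put    = λ _ _ → refl
  ; view        = cons-view
  ; put-↭       = λ _ _ → ↭-refl
  ; put-⊆       = λ p → refl ∷ p
  ; ⊆-put       = λ s xs → s ∷ʳ ⊆-refl
  ; _≼_         = _≤_
  ; ≼-antisym   = ≤-antisym
  ; put-extreme = cons-least
  ; André       = AndreII
  ; André-[]    = empty
  ; André-[-]   = single
  ; André-split = split
  ; André-view  = λ where
      empty                     → inj₁ refl
      (single x)                → inj₂ (inj₁ (x , refl))
      (split v x v' x< a a' y)  → inj₂ (inj₂ (v , x , v' , refl , x< , a , a' , y))
  }

module I where
  open Enumeration typeI public
  open Counting typeI public

module II where
  open Enumeration typeII public
  open Counting typeII public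

-- First and next to last letter in type I

⊆-middle : ∀ {l lo h hi : Word} m → l ⊆ lo → h ⊆ hi → l ++ m ∷ h ⊆ lo ++ m ∷ hi
⊆-middle m l⊆ h⊆ = ⊆.++⁺ l⊆ (refl ∷ h⊆)

⊆-skip : ∀ (lo : Word) {as hi} m → as ⊆ lo ++ hi → as ⊆ lo ++ m ∷ hi
⊆-skip lo m as⊆ = ⊆-trans as⊆ (⊆.++⁺ (⊆-refl {x = lo}) (m ∷ʳ ⊆-refl))

F-∈ : ∀ {w} → 1 ≤ length w → F w ∈ w
F-∈ {x ∷ w} _ = here refl

F-++ : ∀ {w} w' → 1 ≤ length w → F (w ++ w') ≡ F w
F-++ {x ∷ w} w' _ = refl

F-avoids : ∀ {m x v} v' → All (_≢ m) v → x ≢ m → F (v ++ x ∷ v') ≢ m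
F-avoids v' []        x≢m = x≢m
F-avoids v' (y≢m ∷ _) _   = y≢m

count-F : ∀ k lo m hi → length (lo ++ m ∷ hi) ≤ k → All (_≢ m) lo → All (_≢ m) hi →
  count F m (I.words k (lo ++ m ∷ hi)) ≡ ent (length hi) (length lo)
count-F (suc k) [] m hi (s≤s ≤k) _ hi≢ with snoc-view hi
... | inj₁ refl = count-all {stat = F} {ws = [ [ m ] ]} λ { (here refl) → refl }
... | inj₂ (s , hs , refl) = begin
  count F m (I.words (suc k) (m ∷ snoc s hs))
    ≡⟨ I.count-words-put F m k m s hs ⟩
  Σsplits hs (λ as bs → count F m (joins m (I.words k as) (I.words k (snoc s bs))))
    -- `m` is the root here, and it comes first exactly when the left part is empty.
    ≡⟨ Σsplits-[]ˡ hs (λ {a} {as} {bs} i → count-joins-none (I.words k (a ∷ as)) (I.words k (snoc s bs)) λ {v} v∈ _ F≡m →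
         let 1≤ = subst (1 ≤_) (sym (I.words-length k (a ∷ as) v∈)) (s≤s z≤n)
         in All.lookup (I.words-All k (a ∷ as) (⊆.All-resp-⊆ (interleaving-⊆ˡ i) (All.++⁻ˡ hs hi≢)) v∈)
              (F-∈ {v} 1≤) (trans (sym (F-++ {v} _ 1≤)) F≡m)) ⟩
  count F m (joins m [ [] ] (I.words k (snoc s hs)))
    ≡⟨ count-joins-all {stat = F} [ [] ] (I.words k (snoc s hs)) (λ { (here refl) _ → refl }) ⟩
  length (I.words k (snoc s hs)) + 0
    ≡⟨ +-identityʳ _ ⟩
  length (I.words k (snoc s hs))
    ≡⟨ I.length-words k (snoc s hs) ≤k ⟩
  zig (length (snoc s hs)) ∎
  where open ≡-Reasoning
count-F (suc k) (x ∷ lo) m hi (s≤s ≤k) (x≢ ∷ lo≢) hi≢ with snoc-view hi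
-- `m` is the greatest letter, hence forced to the right of the root and never first; this is E_n(n)
-- = 0.
... | inj₁ refl = begin
  count F m (I.words (suc k) (x ∷ lo ++ [ m ]))
    ≡⟨ I.count-words-put F m k x m lo ⟩
  Σsplits lo (λ as bs → count F m (joins x (I.words k as) (I.words k (snoc m bs))))
    ≡⟨ Σsplits-zero lo (λ {as} {bs} i → count-joins-none (I.words k as) (I.words k (snoc m bs)) λ {_} {v'} v∈ _ →
         F-avoids v' (I.words-All k as (⊆.All-resp-⊆ (interleaving-⊆ˡ i) lo≢) v∈) x≢) ⟩
  0 ∎
  where open ≡-Reasoning
... | inj₂ (s , hs , refl) = begin
  count F m (I.words (suc k) (x ∷ lo ++ m ∷ hs ++ [ s ]))
    ≡⟨ cong (λ xs → count F m (I.words (suc k) (x ∷ xs))) assoc ⟩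
  count F m (I.words (suc k) (x ∷ snoc s (lo ++ m ∷ hs)))
    ≡⟨ I.count-words-put F m k x s (lo ++ m ∷ hs) ⟩
  Σsplits (lo ++ m ∷ hs) (λ as bs → count F m (joins x (I.words k as) (I.words k (snoc s bs))))
    -- Only a left part containing `m` can begin with `m`. The right part contains `s` in addition
    -- to `bs`, whence z' in place of z.
    ≡⟨ Σsplits-▷ˡ lo (zig ∘ suc) G inˡ inʳ ⟩
  ((zig ∘ suc) ▷ G) (length lo) (length hs)
    ≡⟨ G-ode (length lo) (length hs) ⟨
  ent (suc (length hs)) (suc (length lo))
    ≡⟨ cong (λ n → ent n (suc (length lo))) (I.length-put s hs) ⟨
  ent (length (snoc s hs)) (suc (length lo)) ∎
  where
  open ≡-Reasoning
  assoc : lo ++ m ∷ hs ++ [ s ] ≡ (lo ++ m ∷ hs) ++ [ s ]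
  assoc = sym (++-assoc lo (m ∷ hs) [ s ])
  rest≤k : length (snoc s (lo ++ m ∷ hs)) ≤ k
  rest≤k = subst (λ xs → length xs ≤ k) assoc ≤k
  hs≢ : All (_≢ m) hs
  hs≢ = All.++⁻ˡ hs hi≢
  inˡ : ∀ {bs l h} → bs ⊆ lo ++ hs → l ⊆ lo → h ⊆ hs →
    count F m (joins x (I.words k (l ++ m ∷ h)) (I.words k (snoc s bs))) ≡ zig (suc (length bs)) * G (length l) (length h)
  inˡ {bs} {l} {h} bs⊆ l⊆ h⊆ = begin
    count F m (joins x (I.words k (l ++ m ∷ h)) (I.words k (snoc s bs)))
      ≡⟨ count-joinsˡ F (I.words k (l ++ m ∷ h)) (I.words k (snoc s bs)) (λ {v} v∈ _ → F-++ {v} _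
           (subst (1 ≤_) (sym (I.words-length k (l ++ m ∷ h) v∈)) (⊆.length-mono-≤ (⊆.++⁺ˡ l (refl ∷ minimum h))))) ⟩
    length (I.words k (snoc s bs)) * count F m (I.words k (l ++ m ∷ h))
      ≡⟨ cong₂ _*_
           (trans (I.length-words k (snoc s bs)
                    (≤-trans (⊆.length-mono-≤ (⊆.++⁺ (⊆-skip lo m bs⊆) ⊆-refl)) rest≤k))
                  (cong zig (I.length-put s bs)))
           (count-F k l m h (≤-trans (⊆.length-mono-≤ (⊆-trans (⊆-middle m l⊆ h⊆) (⊆.++⁺ʳ [ s ] ⊆-refl))) rest≤k)
             (⊆.All-resp-⊆ l⊆ lo≢) (⊆.All-resp-⊆ h⊆ hs≢)) ⟩
    zig (suc (length bs)) * G (length l) (length h) ∎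
  inʳ : ∀ {as l h} → as ⊆ lo ++ hs → l ⊆ lo → h ⊆ hs →
    count F m (joins x (I.words k as) (I.words k (snoc s (l ++ m ∷ h)))) ≡ 0
  inʳ {as} {l} {h} as⊆ _ _ = count-joins-none (I.words k as) (I.words k (snoc s (l ++ m ∷ h))) λ {_} {v'} v∈ _ →
    F-avoids v' (I.words-All k as (⊆.All-resp-⊆ as⊆ (All.++⁺ lo≢ hs≢)) v∈) x≢

NL-[-] : ∀ v x y → NL (v ++ x ∷ y ∷ []) ≡ x
NL-[-] []            x y = refl
NL-[-] (a ∷ [])      x y = refl
NL-[-] (a ∷ b ∷ [])  x y = refl
NL-[-] (a ∷ b ∷ c ∷ v) x y = NL-[-] (b ∷ c ∷ v) x y

NL-++ : ∀ v x v' → 2 ≤ length v' → NL (v ++ x ∷ v') ≡ NL v'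
NL-++ []            x (y ∷ z ∷ v') _ = refl
NL-++ []            x (y ∷ [])     (s≤s ())
NL-++ (a ∷ [])      x (y ∷ v')     p = NL-++ [] x (y ∷ v') p
NL-++ (a ∷ b ∷ [])  x v'           p = NL-++ (b ∷ []) x v' p
NL-++ (a ∷ b ∷ c ∷ v) x v'         p = NL-++ (b ∷ c ∷ v) x v' p

NL-∈ : ∀ w → 2 ≤ length w → NL w ∈ w
NL-∈ (x ∷ [])        (s≤s ())
NL-∈ (x ∷ y ∷ [])    _ = here refl
NL-∈ (x ∷ y ∷ z ∷ w) _ = there (NL-∈ (y ∷ z ∷ w) (s≤s (s≤s z≤n)))

-- The next to last letter is the root if `s` alone follows it, and otherwise it lies in the right
-- part; in neither case can it come from the left part.
NL-avoids : ∀ {p x s v'} v bs → v' ↭ snoc s bs → x ≢ p → All (_≢ p) (snoc s bs) → NL (v ++ x ∷ v') ≢ p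
NL-avoids {x = x} {s} v [] v'↭ x≢p _ NL≡p with refl ← ↭-singleton-inv v'↭ =
  x≢p (trans (sym (NL-[-] v x s)) NL≡p)
NL-avoids {x = x} {s} {v'} v (b ∷ bs) v'↭ _ ≢p NL≡p =
  All.lookup (All-resp-↭ (↭-sym v'↭) ≢p) (NL-∈ v' 2≤) (trans (sym (NL-++ v x v' 2≤)) NL≡p)
  where
  2≤ : 2 ≤ length v'
  2≤ = subst (2 ≤_) (sym (trans (↭-length v'↭) (I.length-put s (b ∷ bs)))) (s≤s (s≤s z≤n))

-- The greatest letter `s` goes right at every root, so the recursion always follows the right part.
-- It is kept out of `hi` because it is never the value counted.
count-NL : ∀ k lo p hi s → length (lo ++ p ∷ snoc s hi) ≤ k → All (_≢ p) lo → All (_≢ p) (snoc s hi) →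
  count NL p (I.words k (lo ++ p ∷ snoc s hi)) ≡ P (length lo) (length hi)
count-NL (suc k) [] p hi s (s≤s ≤k) _ hi≢ = begin
  count NL p (I.words (suc k) (p ∷ snoc s hi))
    ≡⟨ I.count-words-put NL p k p s hi ⟩
  Σsplits hi (λ as bs → count NL p (joins p (I.words k as) (I.words k (snoc s bs))))
    -- The root `p` is next to last exactly when `s` is alone to its right; the left part is then
    -- any word on `hi`.
    ≡⟨ Σsplits-[]ʳ hi (λ {as} {b} {bs} i → count-joins-none (I.words k as) (I.words k (snoc s (b ∷ bs)))
         λ {v} {v'} _ v'∈ NL≡p → let
             v'↭ = I.words-↭ k (snoc s (b ∷ bs)) v'∈
             2≤  = subst (2 ≤_) (sym (trans (↭-length v'↭) (I.length-put s (b ∷ bs)))) (s≤s (s≤s z≤n))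
           in All.lookup (All-resp-↭ (↭-sym v'↭) (⊆.All-resp-⊆ (⊆.++⁺ (interleaving-⊆ʳ i) ⊆-refl) hi≢))
                (NL-∈ v' 2≤) (trans (sym (NL-++ v p v' 2≤)) NL≡p)) ⟩
  count NL p (joins p (I.words k hi) (I.words k [ s ]))
    ≡⟨ count-joins-all (I.words k hi) (I.words k [ s ]) root ⟩
  length (I.words k hi) * length (I.words k [ s ])
    ≡⟨ cong₂ _*_ (I.length-words k hi (≤-trans (⊆.length-mono-≤ (⊆.++⁺ʳ [ s ] (⊆-refl {x = hi}))) ≤k))
                 (I.length-words k [ s ] (≤-trans (⊆.length-mono-≤ (⊆.++⁺ˡ hi ⊆-refl)) ≤k)) ⟩
  zig (length hi) * 1
    ≡⟨ *-identityʳ _ ⟩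
  zig (length hi)
    ≡⟨ ent-1 (length hi) ⟨
  ent 1 (length hi) ∎
  where
  open ≡-Reasoning
  root : ∀ {v v'} → v ∈ I.words k hi → v' ∈ I.words k [ s ] → NL (v ++ p ∷ v') ≡ p
  root {v} _ v'∈ with refl ← ↭-singleton-inv (I.words-↭ k [ s ] v'∈) = NL-[-] v p s
count-NL (suc k) (x ∷ lo) p hi s (s≤s ≤k) (x≢ ∷ lo≢) hi≢ = begin
  count NL p (I.words (suc k) (x ∷ lo ++ p ∷ hi ++ [ s ]))
    ≡⟨ cong (λ xs → count NL p (I.words (suc k) (x ∷ xs))) assoc ⟩
  count NL p (I.words (suc k) (x ∷ snoc s (lo ++ p ∷ hi)))
    ≡⟨ I.count-words-put NL p k x s (lo ++ p ∷ hi) ⟩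
  Σsplits (lo ++ p ∷ hi) (λ as bs → count NL p (joins x (I.words k as) (I.words k (snoc s bs))))
    ≡⟨ Σsplits-▷ʳ lo zig P inʳ inˡ ⟩
  (zig ▷ P) (length lo) (length hi)
    ≡⟨ P-ode (length lo) (length hi) ⟨
  P (suc (length lo)) (length hi) ∎
  where
  open ≡-Reasoning
  assoc : lo ++ p ∷ hi ++ [ s ] ≡ (lo ++ p ∷ hi) ++ [ s ]
  assoc = sym (++-assoc lo (p ∷ hi) [ s ])
  inʳ : ∀ {as l h} → as ⊆ lo ++ hi → l ⊆ lo → h ⊆ hi →
    count NL p (joins x (I.words k as) (I.words k (snoc s (l ++ p ∷ h)))) ≡ zig (length as) * P (length l) (length h)
  inʳ {as} {l} {h} as⊆ l⊆ h⊆ = begin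
    count NL p (joins x (I.words k as) (I.words k (snoc s (l ++ p ∷ h))))
      ≡⟨ cong (λ xs → count NL p (joins x (I.words k as) (I.words k xs))) (++-assoc l (p ∷ h) [ s ]) ⟩
    count NL p (joins x (I.words k as) (I.words k (l ++ p ∷ snoc s h)))
      ≡⟨ count-joinsʳ NL (I.words k as) (I.words k (l ++ p ∷ snoc s h)) (λ {v} {v'} _ v'∈ → NL-++ v x v'
           (subst (2 ≤_) (sym (I.words-length k (l ++ p ∷ snoc s h) v'∈))
             (⊆.length-mono-≤ (⊆.++⁺ˡ l (refl {x = p} ∷ ⊆.++⁺ˡ h (⊆-refl {x = [ s ]})))))) ⟩
    length (I.words k as) * count NL p (I.words k (l ++ p ∷ snoc s h))
      ≡⟨ cong₂ _*_
           (I.length-words k as (≤-trans (⊆.length-mono-≤ (⊆-trans (⊆-skip lo p as⊆) (⊆.++⁺ʳ [ s ] ⊆-refl)))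
             (subst (λ xs → length xs ≤ k) assoc ≤k)))
           (count-NL k l p h s (≤-trans (⊆.length-mono-≤ (⊆-middle p l⊆ (⊆.++⁺ h⊆ ⊆-refl))) ≤k)
             (⊆.All-resp-⊆ l⊆ lo≢) (⊆.All-resp-⊆ (⊆.++⁺ h⊆ ⊆-refl) hi≢)) ⟩
    zig (length as) * P (length l) (length h) ∎
  inˡ : ∀ {bs l h} → bs ⊆ lo ++ hi → l ⊆ lo → h ⊆ hi →
    count NL p (joins x (I.words k (l ++ p ∷ h)) (I.words k (snoc s bs))) ≡ 0
  inˡ {bs} {l} {h} bs⊆ _ _ = count-joins-none (I.words k (l ++ p ∷ h)) (I.words k (snoc s bs)) λ {v} _ v'∈ →
    NL-avoids v bs (I.words-↭ k (snoc s bs) v'∈) x≢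
      (⊆.All-resp-⊆ (⊆.++⁺ bs⊆ ⊆-refl) (subst (All (_≢ p)) (sym (++-assoc lo hi [ s ])) (All.++⁺ lo≢ hi≢)))

-- Last letter in type II

L-++ : ∀ v x v' → 1 ≤ length v' → L (v ++ x ∷ v') ≡ L v'
L-++ []          x (y ∷ v') _ = refl
L-++ (a ∷ [])    x v'       p = L-++ [] x v' p
L-++ (a ∷ b ∷ v) x v'       p = L-++ (b ∷ v) x v' p

L-∈ : ∀ w → 1 ≤ length w → L w ∈ w
L-∈ (x ∷ [])    _ = here refl
L-∈ (x ∷ y ∷ w) _ = there (L-∈ (y ∷ w) (s≤s z≤n))

L-avoids : ∀ {m v'} v x → 1 ≤ length v' → All (_≢ m) v' → L (v ++ x ∷ v') ≢ m
L-avoids {v' = v'} v x 1≤ ≢m L≡m = All.lookup ≢m (L-∈ v' 1≤) (trans (sym (L-++ v x v' 1≤)) L≡m)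

-- With at least two letters the right part is nonempty and holds the last letter, so a least letter
-- is last only in a one-letter word. The least letter of `lo` is the root and the second one is
-- forced to the right, hence the cases for the length of `lo`.
count-L : ∀ k lo m hi → length (lo ++ m ∷ hi) ≤ k → All (_≢ m) lo → All (_≢ m) hi →
  count L m (II.words k (lo ++ m ∷ hi)) ≡ ent (length lo) (length hi)
count-L (suc k) [] m [] _ _ _ = count-all {stat = L} {ws = [ [ m ] ]} λ { (here refl) → refl }
count-L (suc k) [] m (y ∷ hi) _ _ (y≢ ∷ hi≢) = begin
  count L m (II.words (suc k) (m ∷ y ∷ hi))
    ≡⟨ II.count-words-put L m k m y hi ⟩
  Σsplits hi (λ as bs → count L m (joins m (II.words k as) (II.words k (y ∷ bs))))
    ≡⟨ Σsplits-zero hi (λ {as} {bs} i → count-joins-none (II.words k as) (II.words k (y ∷ bs)) λ {v} _ v'∈ →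
         L-avoids v m (subst (1 ≤_) (sym (II.words-length k (y ∷ bs) v'∈)) (s≤s z≤n))
           (II.words-All k (y ∷ bs) (y≢ ∷ ⊆.All-resp-⊆ (interleaving-⊆ʳ i) hi≢) v'∈)) ⟩
  0 ∎
  where open ≡-Reasoning
count-L (suc k) (x ∷ []) m hi (s≤s ≤k) _ hi≢ = begin
  count L m (II.words (suc k) (x ∷ m ∷ hi))
    ≡⟨ II.count-words-put L m k x m hi ⟩
  Σsplits hi (λ as bs → count L m (joins x (II.words k as) (II.words k (m ∷ bs))))
    -- `m` is the forced letter and is the least of the right part, so it must be alone there: the
    -- right factor is the series 1.
    ≡⟨ Σsplits-⋆ hi zig (ent 0) product ⟩
  (zig ⋆ ent 0) (length hi)
    ≡⟨ ⋆-identityʳ zig (length hi) ⟩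
  zig (length hi)
    ≡⟨ ent-1 (length hi) ⟨
  ent 1 (length hi) ∎
  where
  open ≡-Reasoning
  product : ∀ {as bs} → Interleaving as bs hi →
    count L m (joins x (II.words k as) (II.words k (m ∷ bs))) ≡ zig (length as) * ent 0 (length bs)
  product {as} {bs} i = trans
    (count-joinsʳ L (II.words k as) (II.words k (m ∷ bs)) λ {v} {v'} _ v'∈ →
      L-++ v x v' (subst (1 ≤_) (sym (II.words-length k (m ∷ bs) v'∈)) (s≤s z≤n)))
    (cong₂ _*_ (II.length-words k as (II.fuel-left {s = m} ≤k i))
      (count-L k [] m bs (II.fuel-right {s = m} ≤k i) [] (⊆.All-resp-⊆ (interleaving-⊆ʳ i) hi≢)))
count-L (suc k) (x ∷ y ∷ lo) m hi (s≤s ≤k) (_ ∷ y≢ ∷ lo≢) hi≢ = begin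
  count L m (II.words (suc k) (x ∷ y ∷ lo ++ m ∷ hi))
    ≡⟨ II.count-words-put L m k x y (lo ++ m ∷ hi) ⟩
  Σsplits (lo ++ m ∷ hi) (λ as bs → count L m (joins x (II.words k as) (II.words k (y ∷ bs))))
    -- The forced letter `y` stays with `m` and below it. The extra smaller letter turns
    -- `ent (length l)` into `P (length l)`.
    ≡⟨ Σsplits-▷ʳ lo zig P inʳ inˡ ⟩
  (zig ▷ P) (length lo) (length hi)
    ≡⟨ P-ode (length lo) (length hi) ⟨
  ent (suc (suc (length lo))) (length hi) ∎
  where
  open ≡-Reasoning
  nonempty : ∀ {bs v'} → v' ∈ II.words k (y ∷ bs) → 1 ≤ length v'
  nonempty {bs} v'∈ = subst (1 ≤_) (sym (II.words-length k (y ∷ bs) v'∈)) (s≤s z≤n)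
  inʳ : ∀ {as l h} → as ⊆ lo ++ hi → l ⊆ lo → h ⊆ hi →
    count L m (joins x (II.words k as) (II.words k (y ∷ l ++ m ∷ h))) ≡ zig (length as) * P (length l) (length h)
  inʳ {as} {l} {h} as⊆ l⊆ h⊆ = trans
    (count-joinsʳ L (II.words k as) (II.words k (y ∷ l ++ m ∷ h)) λ {v} {v'} _ v'∈ →
      L-++ v x v' (nonempty {l ++ m ∷ h} v'∈))
    (cong₂ _*_
      (II.length-words k as (≤-trans (⊆.length-mono-≤ (y ∷ʳ ⊆-skip lo m as⊆)) ≤k))
      (count-L k (y ∷ l) m h (≤-trans (⊆.length-mono-≤ (⊆-middle m (refl {x = y} ∷ l⊆) h⊆)) ≤k)
        (y≢ ∷ ⊆.All-resp-⊆ l⊆ lo≢) (⊆.All-resp-⊆ h⊆ hi≢)))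
  inˡ : ∀ {bs l h} → bs ⊆ lo ++ hi → l ⊆ lo → h ⊆ hi →
    count L m (joins x (II.words k (l ++ m ∷ h)) (II.words k (y ∷ bs))) ≡ 0
  inˡ {bs} {l} {h} bs⊆ _ _ = count-joins-none (II.words k (l ++ m ∷ h)) (II.words k (y ∷ bs)) λ {v} _ v'∈ →
    L-avoids v x (nonempty {bs} v'∈)
      (II.words-All k (y ∷ bs) (y≢ ∷ ⊆.All-resp-⊆ bs⊆ (All.++⁺ lo≢ hi≢)) v'∈)

-- Greatest neighbour of the maximum in type II

-- The continuation is felt only if `n` ends `v`, where the default 0 for the next letter becomes
-- `x`. The scan keeps the previous letter at least `x`, so the maximum does not change.
grnAux-++ˡ : ∀ {n q x v} v' → n ∈ v → All (x ≤_) v → x ≤ q → grnAux n q (v ++ x ∷ v') ≡ grnAux n q v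
grnAux-++ˡ {n} {v = y ∷ v} v' n∈ (x≤y ∷ x≤v) x≤q with y ≟ n
grnAux-++ˡ {v = y ∷ []}    v' n∈ _ x≤q        | yes _ = trans (m≥n⇒m⊔n≡m x≤q) (sym (⊔-identityʳ _))
grnAux-++ˡ {v = y ∷ _ ∷ _} v' n∈ _ x≤q        | yes _ = refl
grnAux-++ˡ v' (here n≡y) (x≤y ∷ x≤v) x≤q      | no y≢n = contradiction (sym n≡y) y≢n
grnAux-++ˡ v' (there n∈) (x≤y ∷ x≤v) x≤q      | no y≢n = grnAux-++ˡ v' n∈ x≤v x≤y

grn-++ˡ : ∀ {n x v} v' → n ∈ v → All (x ≤_) v → 2 ≤ length v → grn n (v ++ x ∷ v') ≡ grn n v
grn-++ˡ {n} {v = y ∷ []}    v' _  _           (s≤s ())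
grn-++ˡ {n} {v = y ∷ z ∷ v} v' n∈ (x≤y ∷ x≤v) _ with y ≟ n
... | yes _ = refl
grn-++ˡ v' (here n≡y) (x≤y ∷ x≤v) _ | no y≢n = contradiction (sym n≡y) y≢n
grn-++ˡ v' (there n∈) (x≤y ∷ x≤v) _ | no y≢n = grnAux-++ˡ v' n∈ x≤v x≤y

grn-[-] : ∀ n x v' → grn n (n ∷ x ∷ v') ≡ x
grn-[-] n x v' with n ≟ n
... | yes _  = refl
... | no n≢n = contradiction refl n≢n

grnAux-++ʳ : ∀ {n q x v} v' → All (_≢ n) v → x ≢ n → grnAux n q (v ++ x ∷ v') ≡ grnAux n x v'
grnAux-++ʳ {n} {x = x} v' [] x≢n with x ≟ n
... | yes x≡n = contradiction x≡n x≢n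
... | no _    = refl
grnAux-++ʳ {n} {v = y ∷ v} v' (y≢n ∷ v≢n) x≢n with y ≟ n
... | yes y≡n = contradiction y≡n y≢n
... | no _    = grnAux-++ʳ v' v≢n x≢n

-- Starting with `x` instead of 0 is felt only if `v` begins with `n`, and then the second letter of
-- `v` is at least `x`. The length bound guarantees that letter.
grnAux-grn : ∀ {n x v} → All (x ≤_) v → 2 ≤ length v → grnAux n x v ≡ grn n v
grnAux-grn {v = y ∷ []}    _ (s≤s ())
grnAux-grn {n} {v = y ∷ z ∷ v} (_ ∷ x≤z ∷ _) _ with y ≟ n
... | yes _ = m≤n⇒m⊔n≡n x≤z
... | no _  = refl

grn-++ʳ : ∀ {n x v v'} → All (_≢ n) v → x ≢ n → All (x ≤_) v' → 2 ≤ length v' → grn n (v ++ x ∷ v') ≡ grn n v'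
grn-++ʳ {v' = v'} v≢n x≢n x≤v' 2≤ = trans (grnAux-++ʳ v' v≢n x≢n) (grnAux-grn x≤v' 2≤)

grnAux-∈ : ∀ {n} q v → n ∈ v → grnAux n q v ∈ q ∷ v
grnAux-∈ {n} q (y ∷ v) n∈ with y ≟ n
grnAux-∈ q (y ∷ [])    n∈ | yes _ = here (⊔-identityʳ q)
grnAux-∈ q (y ∷ z ∷ v) n∈ | yes _ with ⊔-sel q z
... | inj₁ ≡q = here ≡q
... | inj₂ ≡z = there (there (here ≡z))
grnAux-∈ q (y ∷ v) (here n≡y) | no y≢n = contradiction (sym n≡y) y≢n
grnAux-∈ q (y ∷ v) (there n∈) | no _   = there (grnAux-∈ y v n∈)

grn-∈ : ∀ {n} v → n ∈ v → 2 ≤ length v → grn n v ∈ v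
grn-∈ (y ∷ []) _ (s≤s ())
grn-∈ {n} (y ∷ z ∷ v) n∈ _ with y ≟ n
... | yes _ = there (here refl)
grn-∈ (y ∷ z ∷ v) (here n≡y) _ | no y≢n = contradiction (sym n≡y) y≢n
grn-∈ (y ∷ z ∷ v) (there n∈) _ | no _   = grnAux-∈ y (z ∷ v) n∈

grn-avoidsˡ : ∀ {n p x v} v' → n ∈ v → All (x ≤_) v → All (_≢ p) v → x ≢ p → grn n (v ++ x ∷ v') ≢ p
grn-avoidsˡ {x = x} {y ∷ []} v' (here refl) _ _ x≢p grn≡p = x≢p (trans (sym (grn-[-] y x v')) grn≡p)
grn-avoidsˡ {v = y ∷ z ∷ v} v' n∈ x≤v v≢p _ grn≡p =
  All.lookup v≢p (grn-∈ (y ∷ z ∷ v) n∈ 2≤) (trans (sym (grn-++ˡ v' n∈ x≤v 2≤)) grn≡p)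
  where 2≤ = s≤s (s≤s z≤n)

grn-avoidsʳ : ∀ {n p x v v'} → All (_≢ n) v → x ≢ n → n ∈ v' → 2 ≤ length v' → All (x ≤_) v' → All (_≢ p) v' →
  grn n (v ++ x ∷ v') ≢ p
grn-avoidsʳ {v' = v'} v≢n x≢n n∈ 2≤ x≤v' v'≢p grn≡p =
  All.lookup v'≢p (grn-∈ v' n∈ 2≤) (trans (sym (grn-++ʳ v≢n x≢n x≤v' 2≤)) grn≡p)

sorted-middle : ∀ lo {m hi} → Sorted (lo ++ m ∷ hi) → All (_< m) lo × All (m <_) hi
sorted-middle []       (m< ∷ _) = [] , m<
sorted-middle (x ∷ lo) (x< ∷ s) =
  All.lookup x< (∈-++⁺ʳ lo (here refl)) ∷ proj₁ (sorted-middle lo s) , proj₂ (sorted-middle lo s)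

-- The letter `n` may lie on either side of the root. If its part has another letter, the root is
-- too small to be the greatest neighbour, so the value is found inside that part.
count-grn : ∀ k lo p mid n → length (lo ++ p ∷ snoc n mid) ≤ k → Sorted (lo ++ p ∷ snoc n mid) →
  count (grn n) p (II.words k (lo ++ p ∷ snoc n mid)) ≡ P (length lo) (length mid)
count-grn (suc (suc k)) [] p [] n _ ((p<n ∷ _) ∷ _) =
  count-all {stat = grn n} {ws = [ p ∷ n ∷ [] ]} λ { (here refl) → edge }
  where
  edge : grn n (p ∷ n ∷ []) ≡ p
  edge with p ≟ n
  ... | yes p≡n = contradiction p≡n (<⇒≢ p<n)
  ... | no _ with n ≟ n
  ...   | yes _  = ⊔-identityʳ p
  ...   | no n≢n = contradiction refl n≢n
count-grn (suc zero) [] p [] n (s≤s ()) _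
count-grn (suc k) [] p (y ∷ mid) n (s≤s ≤k) (p<@(p<y ∷ p<mid) ∷ y-sorted) = begin
  count (grn n) p (II.words (suc k) (p ∷ y ∷ snoc n mid))
    ≡⟨ II.count-words-put (grn n) p k p y (snoc n mid) ⟩
  Σsplits (snoc n mid) (λ as bs → count (grn n) p (joins p (II.words k as) (II.words k (y ∷ bs))))
    ≡⟨ Σsplits-snoc mid n _ ⟩
  Σsplits mid (λ as bs → count (grn n) p (joins p (II.words k (snoc n as)) (II.words k (y ∷ bs))))
    + Σsplits mid (λ as bs → count (grn n) p (joins p (II.words k as) (II.words k (y ∷ snoc n bs))))
    -- The root `p` is the greatest neighbour only if `n` is alone on the left; on the right `n` is
    -- accompanied by the forced letter `y`.
    ≡⟨ cong₂ _+_ (Σsplits-[]ˡ mid n-left) (Σsplits-zero mid n-right) ⟩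
  count (grn n) p (joins p (II.words k [ n ]) (II.words k (y ∷ mid))) + 0
    ≡⟨ +-identityʳ _ ⟩
  count (grn n) p (joins p (II.words k [ n ]) (II.words k (y ∷ mid)))
    ≡⟨ count-joins-all (II.words k [ n ]) (II.words k (y ∷ mid)) root ⟩
  length (II.words k [ n ]) * length (II.words k (y ∷ mid))
    ≡⟨ cong₂ _*_ (II.length-words k [ n ] (≤-trans (⊆.length-mono-≤ (⊆.++⁺ˡ (y ∷ mid) (⊆-refl {x = [ n ]}))) ≤k))
                 (II.length-words k (y ∷ mid) (≤-trans (⊆.length-mono-≤ (⊆.++⁺ʳ [ n ] (⊆-refl {x = y ∷ mid}))) ≤k)) ⟩
  zig (length (y ∷ mid)) + 0
    ≡⟨ +-identityʳ _ ⟩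
  zig (length (y ∷ mid))
    ≡⟨ ent-1 (length (y ∷ mid)) ⟨
  ent 1 (length (y ∷ mid)) ∎
  where
  open ≡-Reasoning
  p≤ : ∀ {xs} → xs ⊆ y ∷ snoc n mid → All (p ≤_) xs
  p≤ q = All.map <⇒≤ (⊆.All-resp-⊆ q p<)
  ≢p : ∀ {xs} → xs ⊆ y ∷ snoc n mid → All (_≢ p) xs
  ≢p q = All.map >⇒≢ (⊆.All-resp-⊆ q p<)
  mid≢n : All (_≢ n) mid
  mid≢n = All.map <⇒≢ (proj₁ (sorted-middle mid (AllPairs.tail y-sorted)))
  p≢n : p ≢ n
  p≢n = <⇒≢ (All.lookup p<mid (∈-++⁺ʳ mid (here refl)))
  root : ∀ {v v'} → v ∈ II.words k [ n ] → v' ∈ II.words k (y ∷ mid) → grn n (v ++ p ∷ v') ≡ p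
  root {v' = v'} v∈ _ with refl ← ↭-singleton-inv (II.words-↭ k [ n ] v∈) = grn-[-] n p v'
  n-left : ∀ {a as bs} → Interleaving (a ∷ as) bs mid →
    count (grn n) p (joins p (II.words k (snoc n (a ∷ as))) (II.words k (y ∷ bs))) ≡ 0
  n-left {a} {as} {bs} i = count-joins-none (II.words k as⁺) (II.words k (y ∷ bs)) λ {v} {v'} v∈ _ grn≡p →
    let v↭ = II.words-↭ k as⁺ v∈
        n∈v = ∈-resp-↭ (↭-sym v↭) (∈-++⁺ʳ (a ∷ as) (here refl))
        2≤ = subst (2 ≤_) (sym (trans (↭-length v↭) (I.length-put n (a ∷ as)))) (s≤s (s≤s z≤n))
    in All.lookup (II.words-All k as⁺ (≢p as⁺⊆) v∈) (grn-∈ v n∈v 2≤)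
         (trans (sym (grn-++ˡ v' n∈v (II.words-All k as⁺ (p≤ as⁺⊆) v∈) 2≤)) grn≡p)
    where
    as⁺ = snoc n (a ∷ as)
    as⁺⊆ : as⁺ ⊆ y ∷ snoc n mid
    as⁺⊆ = y ∷ʳ ⊆.++⁺ (interleaving-⊆ˡ i) ⊆-refl
  n-right : ∀ {as bs} → Interleaving as bs mid →
    count (grn n) p (joins p (II.words k as) (II.words k (y ∷ snoc n bs))) ≡ 0
  n-right {as} {bs} i = count-joins-none (II.words k as) (II.words k bs⁺) λ {v} {v'} v∈ v'∈ →
    let v'↭ = II.words-↭ k bs⁺ v'∈
    in grn-avoidsʳ (II.words-All k as (⊆.All-resp-⊆ (interleaving-⊆ˡ i) mid≢n) v∈) p≢n
         (∈-resp-↭ (↭-sym v'↭) (∈-++⁺ʳ (y ∷ bs) (here refl)))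
         (subst (2 ≤_) (sym (trans (↭-length v'↭) (I.length-put n (y ∷ bs)))) (s≤s (s≤s z≤n)))
         (II.words-All k bs⁺ (p≤ bs⁺⊆) v'∈) (II.words-All k bs⁺ (≢p bs⁺⊆) v'∈)
    where
    bs⁺ = y ∷ snoc n bs
    bs⁺⊆ : bs⁺ ⊆ y ∷ snoc n mid
    bs⁺⊆ = refl ∷ ⊆.++⁺ (interleaving-⊆ʳ i) ⊆-refl
count-grn (suc k) (x ∷ []) p mid n (s≤s ≤k) (x<@(x<p ∷ x<mid) ∷ p-sorted@(p< ∷ mid-sorted)) = begin
  count (grn n) p (II.words (suc k) (x ∷ p ∷ snoc n mid))
    ≡⟨ II.count-words-put (grn n) p k x p (snoc n mid) ⟩
  Σsplits (snoc n mid) (λ as bs → count (grn n) p (joins x (II.words k as) (II.words k (p ∷ bs))))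
    ≡⟨ Σsplits-snoc mid n _ ⟩
  Σsplits mid (λ as bs → count (grn n) p (joins x (II.words k (snoc n as)) (II.words k (p ∷ bs))))
    + Σsplits mid (λ as bs → count (grn n) p (joins x (II.words k as) (II.words k (p ∷ snoc n bs))))
    -- `p` is forced to the right, so `n` must go right as well; `p` is then the least letter of its
    -- part, where the count is `P 0`.
    ≡⟨ cong₂ _+_ (Σsplits-zero mid n-left) (Σsplits-⋆ mid zig (P 0) n-right) ⟩
  (zig ⋆ P 0) (length mid)
    ≡⟨ P-ode 0 (length mid) ⟨
  P 1 (length mid) ∎
  where
  open ≡-Reasoning
  x≤ : ∀ {xs} → xs ⊆ p ∷ snoc n mid → All (x ≤_) xs
  x≤ q = All.map <⇒≤ (⊆.All-resp-⊆ q x<)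
  mid≢n : All (_≢ n) mid
  mid≢n = All.map <⇒≢ (proj₁ (sorted-middle mid mid-sorted))
  x≢n : x ≢ n
  x≢n = <⇒≢ (All.lookup x<mid (∈-++⁺ʳ mid (here refl)))
  n-left : ∀ {as bs} → Interleaving as bs mid →
    count (grn n) p (joins x (II.words k (snoc n as)) (II.words k (p ∷ bs))) ≡ 0
  n-left {as} {bs} i = count-joins-none (II.words k as⁺) (II.words k (p ∷ bs)) λ {v} {v'} v∈ _ →
    grn-avoidsˡ v' (∈-resp-↭ (↭-sym (II.words-↭ k as⁺ v∈)) (∈-++⁺ʳ as (here refl)))
      (II.words-All k as⁺ (x≤ (p ∷ʳ as⁺⊆)) v∈)
      (II.words-All k as⁺ (All.map >⇒≢ (⊆.All-resp-⊆ as⁺⊆ p<)) v∈)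
      (<⇒≢ x<p)
    where
    as⁺ = snoc n as
    as⁺⊆ : as⁺ ⊆ snoc n mid
    as⁺⊆ = ⊆.++⁺ (interleaving-⊆ˡ i) ⊆-refl
  n-right : ∀ {as bs} → Interleaving as bs mid →
    count (grn n) p (joins x (II.words k as) (II.words k (p ∷ snoc n bs))) ≡ zig (length as) * P 0 (length bs)
  n-right {as} {bs} i = trans
    (count-joinsʳ (grn n) (II.words k as) (II.words k bs⁺) λ {v} {v'} v∈ v'∈ →
      grn-++ʳ (II.words-All k as (⊆.All-resp-⊆ (interleaving-⊆ˡ i) mid≢n) v∈) x≢n
        (II.words-All k bs⁺ (x≤ bs⁺⊆) v'∈)
        (subst (2 ≤_) (sym (trans (II.words-length k bs⁺ v'∈) (I.length-put n (p ∷ bs)))) (s≤s (s≤s z≤n))))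
    (cong₂ _*_
      (II.length-words k as (≤-trans (⊆.length-mono-≤ (p ∷ʳ ⊆-trans (interleaving-⊆ˡ i) (⊆.++⁺ʳ [ n ] ⊆-refl))) ≤k))
      (count-grn k [] p bs n (≤-trans (⊆.length-mono-≤ bs⁺⊆) ≤k) (sorted-⊆ bs⁺⊆ p-sorted)))
    where
    bs⁺ = p ∷ snoc n bs
    bs⁺⊆ : bs⁺ ⊆ p ∷ snoc n mid
    bs⁺⊆ = refl ∷ ⊆.++⁺ (interleaving-⊆ʳ i) ⊆-refl
count-grn (suc k) (x ∷ y ∷ lo) p mid n (s≤s ≤k) (x<@(_ ∷ x<rest) ∷ y-sorted@(y< ∷ rest-sorted)) = begin
  count (grn n) p (II.words (suc k) (x ∷ y ∷ lo ++ p ∷ snoc n mid))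
    ≡⟨ II.count-words-put (grn n) p k x y (lo ++ p ∷ snoc n mid) ⟩
  Σsplits (lo ++ p ∷ snoc n mid) φ
    ≡⟨ cong (λ xs → Σsplits xs φ) (++-assoc lo (p ∷ mid) [ n ]) ⟨
  Σsplits (snoc n (lo ++ p ∷ mid)) φ
    ≡⟨ Σsplits-snoc (lo ++ p ∷ mid) n φ ⟩
  Σsplits (lo ++ p ∷ mid) (λ as bs → φ (snoc n as) bs) + Σsplits (lo ++ p ∷ mid) (λ as bs → φ as (snoc n bs))
    -- `p` and `n` must lie on the same side. Both left gives z' P and both right gives z ∂x P,
    -- because `y` is forced to the right in either case; the sum is ∂x (z P) by Leibniz' rule.
    ≡⟨ cong₂ _+_ (Σsplits-▷ˡ lo (zig ∘ suc) P pn-left p-right-n-left) (Σsplits-▷ʳ lo zig (∂x P) pn-right p-left-n-right) ⟩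
  (zig ▷ P) (suc (length lo)) (length mid)
    ≡⟨ P-ode (suc (length lo)) (length mid) ⟨
  P (suc (suc (length lo))) (length mid) ∎
  where
  open ≡-Reasoning
  φ : Word → Word → ℕ
  φ as bs = count (grn n) p (joins x (II.words k as) (II.words k (y ∷ bs)))
  rest = lo ++ p ∷ snoc n mid
  x≤ : ∀ {xs} → xs ⊆ y ∷ rest → All (x ≤_) xs
  x≤ q = All.map <⇒≤ (⊆.All-resp-⊆ q x<)
  fuel : ∀ {xs} → xs ⊆ y ∷ rest → length xs ≤ k
  fuel q = ≤-trans (⊆.length-mono-≤ q) ≤k
  p∈rest : p ∈ rest
  p∈rest = ∈-++⁺ʳ lo (here refl)
  n∈rest : n ∈ rest
  n∈rest = ∈-++⁺ʳ lo (there (∈-++⁺ʳ mid (here refl)))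
  others≢p : All (_≢ p) (y ∷ snoc n (lo ++ mid))
  others≢p = <⇒≢ (All.lookup y< p∈rest) ∷ subst (All (_≢ p)) (sym (++-assoc lo mid [ n ]))
    (All.++⁺ (All.map <⇒≢ (proj₁ (sorted-middle lo rest-sorted))) (All.map >⇒≢ (proj₂ (sorted-middle lo rest-sorted))))
  others≢n : All (_≢ n) (lo ++ p ∷ mid)
  others≢n = All.map <⇒≢ (proj₁ (sorted-middle (lo ++ p ∷ mid) (subst Sorted (sym (++-assoc lo (p ∷ mid) [ n ])) rest-sorted)))
  x≢p : x ≢ p
  x≢p = <⇒≢ (All.lookup x<rest p∈rest)
  x≢n : x ≢ n
  x≢n = <⇒≢ (All.lookup x<rest n∈rest)
  n∈snoc : ∀ {xs v} → v ∈ II.words k (snoc n xs) → n ∈ v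
  n∈snoc {xs} v∈ = ∈-resp-↭ (↭-sym (II.words-↭ k (snoc n xs) v∈)) (∈-++⁺ʳ xs (here refl))
  2≤snoc : ∀ {xs v} → 1 ≤ length xs → v ↭ snoc n xs → 2 ≤ length v
  2≤snoc {xs} 1≤ v↭ = subst (2 ≤_) (sym (trans (↭-length v↭) (I.length-put n xs))) (s≤s 1≤)
  1≤middle : ∀ l h → 1 ≤ length (l ++ p ∷ h)
  1≤middle l h = ⊆.length-mono-≤ (⊆.++⁺ˡ l (refl {x = p} ∷ minimum h))
  snoc-⊆ : ∀ {xs} → xs ⊆ lo ++ p ∷ mid → snoc n xs ⊆ rest
  snoc-⊆ {xs} q = subst (snoc n xs ⊆_) (++-assoc lo (p ∷ mid) [ n ]) (⊆.++⁺ q ⊆-refl)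
  pn-left : ∀ {bs l h} → bs ⊆ lo ++ mid → l ⊆ lo → h ⊆ mid →
    φ (snoc n (l ++ p ∷ h)) bs ≡ zig (suc (length bs)) * P (length l) (length h)
  pn-left {bs} {l} {h} bs⊆ l⊆ h⊆ = begin
    φ as⁺ bs
      ≡⟨ count-joinsˡ (grn n) (II.words k as⁺) (II.words k (y ∷ bs)) (λ {v} {v'} v∈ _ →
           grn-++ˡ v' (n∈snoc {l ++ p ∷ h} v∈) (II.words-All k as⁺ (x≤ (y ∷ʳ as⁺⊆)) v∈)
             (2≤snoc {l ++ p ∷ h} (1≤middle l h) (II.words-↭ k as⁺ v∈))) ⟩
    length (II.words k (y ∷ bs)) * count (grn n) p (II.words k as⁺)
      ≡⟨ cong₂ _*_
           (II.length-words k (y ∷ bs) (fuel (refl ∷ ⊆-trans (⊆.++⁺ʳ [ n ] (⊆-skip lo p bs⊆)) (snoc-⊆ ⊆-refl))))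
           (trans (cong (λ xs → count (grn n) p (II.words k xs)) assoc)
             (count-grn k l p h n (fuel (y ∷ʳ middle⊆)) (sorted-⊆ middle⊆ rest-sorted))) ⟩
    zig (suc (length bs)) * P (length l) (length h) ∎
    where
    as⁺ = snoc n (l ++ p ∷ h)
    as⁺⊆ : as⁺ ⊆ rest
    as⁺⊆ = snoc-⊆ (⊆-middle p l⊆ h⊆)
    assoc : as⁺ ≡ l ++ p ∷ snoc n h
    assoc = ++-assoc l (p ∷ h) [ n ]
    middle⊆ : l ++ p ∷ snoc n h ⊆ rest
    middle⊆ = subst (_⊆ rest) assoc as⁺⊆
  p-right-n-left : ∀ {as l h} → as ⊆ lo ++ mid → l ⊆ lo → h ⊆ mid → φ (snoc n as) (l ++ p ∷ h) ≡ 0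
  p-right-n-left {as} {l} {h} as⊆ _ _ = count-joins-none (II.words k (snoc n as)) (II.words k (y ∷ l ++ p ∷ h)) λ {v} {v'} v∈ _ →
    grn-avoidsˡ v' (n∈snoc {as} v∈)
      (II.words-All k (snoc n as) (x≤ (y ∷ʳ snoc-⊆ (⊆-skip lo p as⊆))) v∈)
      (II.words-All k (snoc n as) (⊆.All-resp-⊆ (y ∷ʳ ⊆.++⁺ as⊆ ⊆-refl) others≢p) v∈)
      x≢p
  pn-right : ∀ {as l h} → as ⊆ lo ++ mid → l ⊆ lo → h ⊆ mid →
    φ as (snoc n (l ++ p ∷ h)) ≡ zig (length as) * P (suc (length l)) (length h)
  pn-right {as} {l} {h} as⊆ l⊆ h⊆ = begin
    φ as (snoc n (l ++ p ∷ h))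
      ≡⟨ count-joinsʳ (grn n) (II.words k as) (II.words k bs⁺) (λ {v} {v'} v∈ v'∈ →
           grn-++ʳ (II.words-All k as (⊆.All-resp-⊆ (⊆-skip lo p as⊆) others≢n) v∈) x≢n
             (II.words-All k bs⁺ (x≤ bs⁺⊆) v'∈)
             (2≤snoc {y ∷ l ++ p ∷ h} (s≤s z≤n) (II.words-↭ k bs⁺ v'∈))) ⟩
    length (II.words k as) * count (grn n) p (II.words k bs⁺)
      ≡⟨ cong₂ _*_
           (II.length-words k as (fuel (y ∷ʳ ⊆-trans (⊆.++⁺ʳ [ n ] (⊆-skip lo p as⊆)) (snoc-⊆ ⊆-refl))))
           (trans (cong (λ xs → count (grn n) p (II.words k xs)) assoc)
             (count-grn k (y ∷ l) p h n (fuel middle⊆) (sorted-⊆ middle⊆ y-sorted))) ⟩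
    zig (length as) * P (suc (length l)) (length h) ∎
    where
    bs⁺ = y ∷ snoc n (l ++ p ∷ h)
    bs⁺⊆ : bs⁺ ⊆ y ∷ rest
    bs⁺⊆ = refl ∷ snoc-⊆ (⊆-middle p l⊆ h⊆)
    assoc : bs⁺ ≡ (y ∷ l) ++ p ∷ snoc n h
    assoc = ++-assoc (y ∷ l) (p ∷ h) [ n ]
    middle⊆ : (y ∷ l) ++ p ∷ snoc n h ⊆ y ∷ rest
    middle⊆ = subst (_⊆ y ∷ rest) assoc bs⁺⊆
  p-left-n-right : ∀ {bs l h} → bs ⊆ lo ++ mid → l ⊆ lo → h ⊆ mid → φ (l ++ p ∷ h) (snoc n bs) ≡ 0
  p-left-n-right {bs} {l} {h} bs⊆ l⊆ h⊆ = count-joins-none (II.words k (l ++ p ∷ h)) (II.words k bs⁺) λ {v} {v'} v∈ v'∈ →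
    grn-avoidsʳ (II.words-All k (l ++ p ∷ h) (⊆.All-resp-⊆ (⊆-middle p l⊆ h⊆) others≢n) v∈) x≢n
      (∈-resp-↭ (↭-sym (II.words-↭ k bs⁺ v'∈)) (∈-++⁺ʳ (y ∷ bs) (here refl)))
      (2≤snoc {y ∷ bs} (s≤s z≤n) (II.words-↭ k bs⁺ v'∈))
      (II.words-All k bs⁺ (x≤ (refl ∷ snoc-⊆ (⊆-skip lo p bs⊆))) v'∈)
      (II.words-All k bs⁺ (⊆.All-resp-⊆ (refl ∷ ⊆.++⁺ bs⊆ ⊆-refl) others≢p) v'∈)
    where
    bs⁺ = y ∷ snoc n bs

-- Words on 1, …, n

count-≐ : ∀ {stat stat' m m'} (ws : List Word) → (∀ {w} → stat w ≡ m → stat' w ≡ m') → (∀ {w} → stat' w ≡ m' → stat w ≡ m) →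
  count stat m ws ≡ count stat' m' ws
count-≐ {stat} {stat'} {m} {m'} ws to from =
  cong length (filter-≐ (λ w → stat w ≟ m) (λ w → stat' w ≟ m') (to , from) ws)

-- A positive value of `n ∸ x` rules out truncation, so the subtraction can be inverted.
∸-flip : ∀ {n m x} → 1 ≤ m → n ∸ x ≡ m → x ≡ n ∸ m
∸-flip {n} {x = x} 1≤m refl = sym (m∸[m∸n]≡n x≤n)
  where
  x≤n : x ≤ n
  x≤n with ≤-total x n
  ... | inj₁ x≤n = x≤n
  ... | inj₂ n≤x with () ← subst (1 ≤_) (m≤n⇒m∸n≡0 n≤x) 1≤m

count-∸ : ∀ {n m} stat (ws : List Word) → 1 ≤ m → m ≤ n → count (λ w → n ∸ stat w) m ws ≡ count stat (n ∸ m) ws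
count-∸ stat ws 1≤m m≤n = count-≐ ws (∸-flip 1≤m) (λ eq → trans (cong (_ ∸_) eq) (m∸[m∸n]≡n m≤n))

oneToN-applyUpTo : ∀ n → oneToN n ≡ applyUpTo suc n
oneToN-applyUpTo = map-upTo suc

length-oneToN : ∀ n → length (oneToN n) ≡ n
length-oneToN n = trans (cong length (oneToN-applyUpTo n)) (length-applyUpTo suc n)

oneToN-sorted : ∀ n → Sorted (oneToN n)
oneToN-sorted n = subst Sorted (sym (oneToN-applyUpTo n)) (AllPairs.applyUpTo⁺₁ suc n λ i<j _ → s≤s i<j)

oneToN-positive : ∀ n → All (_≢ 0) (oneToN n)
oneToN-positive n = subst (All (_≢ 0)) (sym (oneToN-applyUpTo n)) (All.applyUpTo⁺₂ suc n λ _ ())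

oneToN-snoc : ∀ n → oneToN (suc n) ≡ snoc (suc n) (oneToN n)
oneToN-snoc n = begin
  oneToN (suc n)                ≡⟨ oneToN-applyUpTo (suc n) ⟩
  applyUpTo suc (suc n)         ≡⟨ applyUpTo-∷ʳ suc n ⟨
  snoc (suc n) (applyUpTo suc n) ≡⟨ cong (snoc (suc n)) (oneToN-applyUpTo n) ⟨
  snoc (suc n) (oneToN n)       ∎
  where open ≡-Reasoning

oneToN-middle : ∀ a b → ∃₂ λ lo hi → oneToN (suc (a + b)) ≡ lo ++ suc a ∷ hi × length lo ≡ a × length hi ≡ b
oneToN-middle a zero    = oneToN a , [] ,
  trans (cong (oneToN ∘ suc) (+-identityʳ a)) (oneToN-snoc a) , length-oneToN a , refl
oneToN-middle a (suc b) with lo , hi , eq , lo≡ , hi≡ ← oneToN-middle a b =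
  lo , snoc last hi , eq' , lo≡ , trans (I.length-put last hi) (cong suc hi≡)
  where
  open ≡-Reasoning
  last = suc (suc (a + b))
  eq' : oneToN (suc (a + suc b)) ≡ lo ++ suc a ∷ snoc last hi
  eq' = begin
    oneToN (suc (a + suc b))             ≡⟨ cong (oneToN ∘ suc) (+-suc a b) ⟩
    oneToN last                          ≡⟨ oneToN-snoc (suc (a + b)) ⟩
    snoc last (oneToN (suc (a + b)))     ≡⟨ cong (snoc last) eq ⟩
    (lo ++ suc a ∷ hi) ++ [ last ]       ≡⟨ ++-assoc lo (suc a ∷ hi) [ last ] ⟩
    lo ++ suc a ∷ snoc last hi           ∎

Entringer-ent : ∀ a b → Entringer (suc (a + b)) (suc a) ≡ ent b a
Entringer-ent a b = cong₂ entD (cong suc (+-comm a b)) (m+n∸m≡n a b)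

wordsI wordsII : ℕ → List Word
wordsI  n = I.words n (oneToN n)
wordsII n = II.words n (oneToN n)

fuel-n : ∀ {n xs} → oneToN n ≡ xs → length xs ≤ n
fuel-n {n} eq = ≤-reflexive (trans (cong length (sym eq)) (length-oneToN n))

count-F-n : ∀ a b → count F (suc a) (wordsI (suc (a + b))) ≡ Entringer (suc (a + b)) (suc a)
count-F-n a b with lo , hi , eq , refl , refl ← oneToN-middle a b = begin
  count F (suc a) (wordsI n)                       ≡⟨ cong (λ xs → count F (suc a) (I.words n xs)) eq ⟩
  count F (suc a) (I.words n (lo ++ suc a ∷ hi))   ≡⟨ count-F n lo (suc a) hi (fuel-n eq) lo≢ hi≢ ⟩
  ent b a                                          ≡⟨ Entringer-ent a b ⟨
  Entringer n (suc a)                              ∎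
  where
  open ≡-Reasoning
  n = suc (a + b)
  middle = sorted-middle lo (subst Sorted eq (oneToN-sorted n))
  lo≢ = All.map <⇒≢ (proj₁ middle)
  hi≢ = All.map >⇒≢ (proj₂ middle)

count-L-n : ∀ a b → count L (suc a) (wordsII (suc (a + b))) ≡ ent a b
count-L-n a b with lo , hi , eq , refl , refl ← oneToN-middle a b = begin
  count L (suc a) (wordsII n)                       ≡⟨ cong (λ xs → count L (suc a) (II.words n xs)) eq ⟩
  count L (suc a) (II.words n (lo ++ suc a ∷ hi))   ≡⟨ count-L n lo (suc a) hi (fuel-n eq) lo≢ hi≢ ⟩
  ent a b                                           ∎
  where
  open ≡-Reasoning
  n = suc (a + b)
  middle = sorted-middle lo (subst Sorted eq (oneToN-sorted n))
  lo≢ = All.map <⇒≢ (proj₁ middle)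
  hi≢ = All.map >⇒≢ (proj₂ middle)

oneToN-middle-snoc : ∀ a b → let n = suc (suc (a + b)) in
  ∃₂ λ lo hi → oneToN n ≡ lo ++ suc a ∷ snoc n hi × length lo ≡ a × length hi ≡ b
oneToN-middle-snoc a b with lo , hi , eq , lo≡ , hi≡ ← oneToN-middle a b =
  lo , hi , trans (oneToN-snoc (suc (a + b))) (trans (cong (snoc _) eq) (++-assoc lo (suc a ∷ hi) _)) , lo≡ , hi≡

count-NL-n : ∀ a b → count NL (suc a) (wordsI (suc (suc (a + b)))) ≡ ent (suc a) b
count-NL-n a b with lo , hi , eq , refl , refl ← oneToN-middle-snoc a b = begin
  count NL (suc a) (wordsI n)                              ≡⟨ cong (λ xs → count NL (suc a) (I.words n xs)) eq ⟩
  count NL (suc a) (I.words n (lo ++ suc a ∷ snoc n hi))   ≡⟨ count-NL n lo (suc a) hi n (fuel-n eq) lo≢ hi≢ ⟩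
  ent (suc a) b                                            ∎
  where
  open ≡-Reasoning
  n = suc (suc (a + b))
  middle = sorted-middle lo (subst Sorted eq (oneToN-sorted n))
  lo≢ = All.map <⇒≢ (proj₁ middle)
  hi≢ = All.map >⇒≢ (proj₂ middle)

count-grn-n : ∀ a b → let n = suc (suc (a + b)) in count (grn n) (suc a) (wordsII n) ≡ ent (suc a) b
count-grn-n a b with lo , hi , eq , refl , refl ← oneToN-middle-snoc a b = begin
  count (grn n) (suc a) (wordsII n)                               ≡⟨ cong (λ xs → count (grn n) (suc a) (II.words n xs)) eq ⟩
  count (grn n) (suc a) (II.words n (lo ++ suc a ∷ snoc n hi))    ≡⟨ count-grn n lo (suc a) hi n (fuel-n eq) (subst Sorted eq (oneToN-sorted n)) ⟩
  ent (suc a) b                                                   ∎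
  where
  open ≡-Reasoning
  n = suc (suc (a + b))

count-0 : ∀ n (stat : Word → ℕ) ws → (∀ {w} → w ∈ ws → w ↭ oneToN n) → (∀ {w} → w ↭ oneToN n → stat w ∈ w) →
  count stat 0 ws ≡ 0
count-0 n stat ws perm stat-∈ = count-none {stat = stat} {ws = ws} λ w∈ →
  All.lookup (All-resp-↭ (↭-sym (perm w∈)) (oneToN-positive n)) (stat-∈ (perm w∈))

-- A statistic n ∸ stat takes the value n exactly where stat vanishes, and E_n(n) = 0.
count-complement : ∀ (stat : ℕ → Word → ℕ) (ws : (n : ℕ) → List Word) →
  (∀ n → 2 ≤ n → count (stat n) 0 (ws n) ≡ 0) →
  (∀ a b → let n = suc (suc (a + b)) in count (stat n) (suc a) (ws n) ≡ ent (suc a) b) →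
  ∀ n → 2 ≤ n → ∀ m → 1 ≤ m → m ≤ n → count (λ w → n ∸ stat n w) m (ws n) ≡ Entringer n m
count-complement stat ws none some n 2≤n (suc b) 1≤m m≤n with m≤n⇒∃[o]m+o≡n m≤n
... | zero , refl = begin
  count (λ w → n ∸ stat n w) (suc b) (ws n)   ≡⟨ count-∸ (stat n) (ws n) 1≤m m≤n ⟩
  count (stat n) (n ∸ suc b) (ws n)           ≡⟨ cong (λ i → count (stat n) i (ws n)) (m+n∸m≡n b 0) ⟩
  count (stat n) 0 (ws n)                     ≡⟨ none n 2≤n ⟩
  0                                           ≡⟨ ent-0 b (subst (2 ≤_) (cong suc (+-identityʳ b)) 2≤n) ⟨
  ent 0 b                                     ≡⟨ Entringer-ent b 0 ⟨
  Entringer n (suc b)                         ∎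
  where
  open ≡-Reasoning
  ent-0 : ∀ b → 2 ≤ suc b → ent 0 b ≡ 0
  ent-0 zero    (s≤s ())
  ent-0 (suc b) _ = refl
... | suc a , refl = begin
  count (λ w → n ∸ stat n w) (suc b) (ws n)   ≡⟨ count-∸ (stat n) (ws n) 1≤m m≤n ⟩
  count (stat n) (n ∸ suc b) (ws n)           ≡⟨ cong (λ i → count (stat n) i (ws n)) (m+n∸m≡n b (suc a)) ⟩
  count (stat n) (suc a) (ws n)               ≡⟨ subst (λ n → count (stat n) (suc a) (ws n) ≡ ent (suc a) b) n≡ (some a b) ⟩
  ent (suc a) b                               ≡⟨ Entringer-ent b (suc a) ⟨
  Entringer n (suc b)                         ∎
  where
  open ≡-Reasoning
  n≡ : suc (suc (a + b)) ≡ suc (b + suc a)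
  n≡ = cong suc (trans (cong suc (+-comm a b)) (sym (+-suc b a)))

module _ (K : Kind) where
  open Kind K
  open Enumeration K
  open Counting K

  -- The enumeration and its cardinality depend on the kind alone, so for each statistic only the
  -- counts remain to be supplied.
  entringerian : ∀ n stat →
    (∀ m → 1 ≤ m → m ≤ n → count stat m (words n (oneToN n)) ≡ Entringer n m) →
    Entringerian n (λ w → IsPerm n w × André w) stat
  entringerian n stat count≡ =
      words n (oneToN n)
    , words-unique n (oneToN n) (oneToN-sorted n)
    , (λ w → mk⇔
        (λ w∈ → words-↭ n (oneToN n) w∈ , words-sound n (oneToN n) (oneToN-sorted n) w∈)
        (λ (w↭ , w-andré) → words-complete n (oneToN n) fuel (oneToN-sorted n) w↭ w-andré))
    , trans (cong ℤ.+_ (trans (length-words n (oneToN n) fuel) (cong zig (length-oneToN n)))) (sym (TangentSecant.E≡zig n))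
    , count≡
    where
    fuel : length (oneToN n) ≤ n
    fuel = ≤-reflexive (length-oneToN n)

theorem1p1 : (n : ℕ) → 2 ≤ n →
    Entringerian n (AndI n) (λ w → F w) ×
    Entringerian n (AndI n) (λ w → n ∸ NL w) ×
    Entringerian n (AndII n) (λ w → (n + 1) ∸ L w) ×
    Entringerian n (AndII n) (λ w → n ∸ grn n w)
theorem1p1 n 2≤n =
    entringerian typeI n F count-first
  , entringerian typeI n (λ w → n ∸ NL w) (count-complement (λ _ → NL) wordsI
      (λ n 2≤n → count-0 n NL (wordsI n) (I.words-↭ n (oneToN n)) λ {w} w↭ → NL-∈ w (long 2≤n w↭))
      count-NL-n n 2≤n)
  , entringerian typeII n (λ w → (n + 1) ∸ L w) count-last
  , entringerian typeII n (λ w → n ∸ grn n w) (count-complement grn wordsII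
      (λ n 2≤n → count-0 n (grn n) (wordsII n) (II.words-↭ n (oneToN n)) λ {w} w↭ →
        grn-∈ w (∈-resp-↭ (↭-sym w↭) (n∈oneToN 2≤n)) (long 2≤n w↭))
      count-grn-n n 2≤n)
  where
  long : ∀ {n w} → 2 ≤ n → w ↭ oneToN n → 2 ≤ length w
  long {n} 2≤n w↭ = subst (2 ≤_) (sym (trans (↭-length w↭) (length-oneToN n))) 2≤n
  n∈oneToN : ∀ {n} → 2 ≤ n → n ∈ oneToN n
  n∈oneToN {suc n} _ = subst (suc n ∈_) (sym (oneToN-snoc n)) (∈-++⁺ʳ (oneToN n) (here refl))
  count-first : ∀ m → 1 ≤ m → m ≤ n → count F m (wordsI n) ≡ Entringer n m
  count-first (suc a) _ m≤n with b , refl ← m≤n⇒∃[o]m+o≡n m≤n = count-F-n a b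
  count-last : ∀ m → 1 ≤ m → m ≤ n → count (λ w → (n + 1) ∸ L w) m (wordsII n) ≡ Entringer n m
  count-last (suc b) 1≤m m≤n with a , refl ← m≤n⇒∃[o]m+o≡n m≤n = begin
    count (λ w → (n + 1) ∸ L w) (suc b) (wordsII n)  ≡⟨ count-∸ L (wordsII n) 1≤m (≤-trans m≤n (m≤m+n n 1)) ⟩
    count L ((n + 1) ∸ suc b) (wordsII n)            ≡⟨ cong (λ i → count L i (wordsII n)) last≡ ⟩
    count L (suc a) (wordsII n)                      ≡⟨ cong (λ i → count L (suc a) (wordsII (suc i))) (+-comm b a) ⟩
    count L (suc a) (wordsII (suc (a + b)))          ≡⟨ count-L-n a b ⟩
    ent a b                                          ≡⟨ Entringer-ent b a ⟨
    Entringer n (suc b)                              ∎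
    where
    open ≡-Reasoning
    last≡ : (n + 1) ∸ suc b ≡ suc a
    last≡ = trans (cong (_∸ suc b) (+-comm n 1)) (trans (cong (_∸ b) (sym (+-suc b a))) (m+n∸m≡n b (suc a)))
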